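{- Let $n\ge 5$ and let $A$ be an antipodal $5$-splitting of $Q_2^n$. Then the collection $\beta(A)$ of $5$-subsets of $\{1,\dots,n\}$ is equivalent to $E$ or to $F$, where $E=\{\{1,2,3,5,6\},\{1,2,4,5,6\},\{1,3,4,5,6\},\{2,3,4,5,6\},\{1,2,3,5,7\},\{1,2,4,5,7\},\{1,3,4,5,7\},\{2,3,4,5,7\},\{1,2,3,6,7\},\{1,2,4,6,7\},\{1,3,4,6,7\},\{2,3,4,6,8\},\{2,3,4,7,8\},\{2,3,6,7,8\},\{2,4,6,7,8\},\{3,4,6,7,8\}\}$ and $F=\{\{1,2,3,5,7\},\{1,2,4,5,7\},\{1,3,4,5,7\},\{2,3,4,5,7\},\{1,2,3,6,7\},\{1,2,4,6,7\},\{1,3,4,6,7\},\{2,3,4,6,7\},\{1,2,3,6,8\},\{1,2,4,6,8\},\{1,3,4,6,8\},\{2,3,4,6,8\},\{1,2,3,5,8\},\{1,2,4,5,8\},\{1,3,4,5,8\},\{2,3,4,5,8\}\}$.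
   Context: $Q_2^n=\{0,1\}^n$. An $m$-face of $Q_2^n$ is a tuple $a=(a_1,\dots,a_n)\in\{0,1,*\}^n$ with exactly $m$ entries $*$, identified with the set $\{x\in Q_2^n: x_i=a_i \text{ whenever } a_i\in\{0,1\}\}$; its direction is $\{i:a_i=*\}$. Faces are parallel if they have the same direction; parallel faces $a,b$ are antipodal if $b_i=1-a_i$ whenever $a_i\ne *$. An antipodal $k$-splitting of $Q_2^n$ is a collection of exactly $2^k$ faces of dimension $n-k$ whose union is $Q_2^n$ and which contains no two distinct parallel non-antipodal faces. For a face $a$, $\beta(a)=\{i: a_i\in\{0,1\}\}$, and for a collection $A$ of faces, $\beta(A)=\{\beta(a):a\in A\}$ (a set, so parallel faces contribute one block). Two collections $U_1$ of subsets of $V_1$ and $U_2$ of subsets of $V_2$ are equivalent if there is an injection $f:V_1\to V_2$ with $U_2=\{f(u):u\in U_1\}$ (or vice versa). -}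

module Defs where

open import Data.Nat using (ℕ; zero; suc; _+_; _∸_; _^_)
open import Data.Bool using (Bool; true; false; not)
open import Data.Fin using (Fin)
open import Data.Vec using (Vec; []; _∷_; lookup; map)
open import Data.List using (List; []; _∷_; length; foldr)
open import Data.List.Membership.Propositional using () renaming (_∈_ to _∈ₗ_)
open import Data.List.Relation.Unary.Unique.Propositional using (Unique)
open import Data.Fin.Subset using (Subset; ⁅_⁆; _∪_; ⊥) renaming (_∈_ to _∈ₛ_)
open import Data.Product using (Σ; ∃; _×_; _,_)
open import Data.Sum using (_⊎_)
open import Relation.Binary.PropositionalEquality using (_≡_; _≢_)
open import Function.Definitions using (Injective)
open import Function.Bundles using (_⇔_)

data Entry : Set where
  fix  : Bool → Entry
  star : Entry

-- A face of Q_2^n (coordinates indexed by Fin n, i.e. 0..n-1 instead of 1..n).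
Face : ℕ → Set
Face n = Vec Entry n

Vertex : ℕ → Set
Vertex n = Vec Bool n

stars : ∀ {n} → Face n → ℕ
stars []            = 0
stars (fix _ ∷ a)   = stars a
stars (star ∷ a)    = suc (stars a)

_∈F_ : ∀ {n} → Vertex n → Face n → Set
x ∈F a = ∀ i → (b : Bool) → lookup a i ≡ fix b → lookup x i ≡ b

isStar : Entry → Bool
isStar (fix _) = false
isStar star    = true

isFixed : Entry → Bool
isFixed (fix _) = true
isFixed star    = false

direction : ∀ {n} → Face n → Subset n
direction a = map isStar a

β : ∀ {n} → Face n → Subset n
β a = map isFixed a

Parallel : ∀ {n} → Face n → Face n → Set
Parallel a b = direction a ≡ direction b

Antipodal : ∀ {n} → Face n → Face n → Set
Antipodal a b = Parallel a b × (∀ i → (c : Bool) → lookup a i ≡ fix c → lookup b i ≡ fix (not c))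

record AntipodalSplitting (n k : ℕ) (A : List (Face n)) : Set where
  field
    distinct  : Unique A
    size      : length A ≡ 2 ^ k
    dim       : ∀ a → a ∈ₗ A → stars a ≡ n ∸ k
    covers    : ∀ (x : Vertex n) → ∃ λ a → a ∈ₗ A × x ∈F a
    antipodal : ∀ a b → a ∈ₗ A → b ∈ₗ A → a ≢ b → Parallel a b → Antipodal a b

Collection : ℕ → Set₁
Collection m = Subset m → Set

βColl : ∀ {n} → List (Face n) → Collection n
βColl A S = ∃ λ a → a ∈ₗ A × β a ≡ S

IsImage : ∀ {m m'} → (Fin m → Fin m') → Subset m → Subset m' → Set
IsImage f u S = ∀ y → (y ∈ₛ S) ⇔ (∃ λ x → x ∈ₛ u × f x ≡ y)

EquivVia : ∀ {m m'} → Collection m → Collection m' → Set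
EquivVia {m} {m'} U₁ U₂ =
  Σ (Fin m → Fin m') λ f → Injective _≡_ _≡_ f
    × (∀ S → U₂ S → ∃ λ u → U₁ u × IsImage f u S)
    × (∀ u → U₁ u → ∃ λ S → U₂ S × IsImage f u S)

Equivalent : ∀ {m m'} → Collection m → Collection m' → Set
Equivalent U₁ U₂ = EquivVia U₁ U₂ ⊎ EquivVia U₂ U₁

listColl : ∀ {m} → List (Subset m) → Collection m
listColl L S = S ∈ₗ L

mk : ∀ {m} → List (Fin m) → Subset m
mk = foldr (λ i s → ⁅ i ⁆ ∪ s) ⊥

-- 1-based element names on ground set {1,...,8} ≅ Fin 8
e : ℕ → Fin 8
e 1 = Fin.zero
e 2 = Fin.suc Fin.zero
e 3 = Fin.suc (Fin.suc Fin.zero)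
e 4 = Fin.suc (Fin.suc (Fin.suc Fin.zero))
e 5 = Fin.suc (Fin.suc (Fin.suc (Fin.suc Fin.zero)))
e 6 = Fin.suc (Fin.suc (Fin.suc (Fin.suc (Fin.suc Fin.zero))))
e 7 = Fin.suc (Fin.suc (Fin.suc (Fin.suc (Fin.suc (Fin.suc Fin.zero)))))
e _ = Fin.suc (Fin.suc (Fin.suc (Fin.suc (Fin.suc (Fin.suc (Fin.suc Fin.zero))))))

s5 : ℕ → ℕ → ℕ → ℕ → ℕ → Subset 8
s5 a b c d f = mk (e a ∷ e b ∷ e c ∷ e d ∷ e f ∷ [])

Elist : List (Subset 8)
Elist = s5 1 2 3 5 6 ∷ s5 1 2 4 5 6 ∷ s5 1 3 4 5 6 ∷ s5 2 3 4 5 6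
      ∷ s5 1 2 3 5 7 ∷ s5 1 2 4 5 7 ∷ s5 1 3 4 5 7 ∷ s5 2 3 4 5 7
      ∷ s5 1 2 3 6 7 ∷ s5 1 2 4 6 7 ∷ s5 1 3 4 6 7 ∷ s5 2 3 4 6 8
      ∷ s5 2 3 4 7 8 ∷ s5 2 3 6 7 8 ∷ s5 2 4 6 7 8 ∷ s5 3 4 6 7 8 ∷ []

Flist : List (Subset 8)
Flist = s5 1 2 3 5 7 ∷ s5 1 2 4 5 7 ∷ s5 1 3 4 5 7 ∷ s5 2 3 4 5 7
      ∷ s5 1 2 3 6 7 ∷ s5 1 2 4 6 7 ∷ s5 1 3 4 6 7 ∷ s5 2 3 4 6 7
      ∷ s5 1 2 3 6 8 ∷ s5 1 2 4 6 8 ∷ s5 1 3 4 6 8 ∷ s5 2 3 4 6 8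
      ∷ s5 1 2 3 5 8 ∷ s5 1 2 4 5 8 ∷ s5 1 3 4 5 8 ∷ s5 2 3 4 5 8 ∷ []

E : Collection 8
E = listColl Elist

F : Collection 8
F = listColl Flist

{-# OPTIONS --safe #-}

-- The 32 faces have total volume 2^n, so they partition the cube, and comparing Fourier coefficients
-- gives Σ_a χ_Q(a) = 0 for every nonempty Q ⊆ {1,…,n}, where χ_Q(a) is the product of the signs of a on
-- Q ⊆ β(a) and is 0 when Q ⊄ β(a).  Q = β(a) shows that the antipode of every face is a face.
-- Disjointness of a face from another face and from its antipode shows that two non-parallel faces
-- agree somewhere, disagree somewhere, and have at most 4 common fixed coordinates.  For |Q| = 4, a
-- family of faces (up to antipodes) whose signs on Q do not cancel forces a further face through Q
-- with the opposite sign.  These two facts drive a finite backtracking search over families of sign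
-- patterns on the coordinates met so far.  If some two faces agree twice and disagree twice, the
-- search started from such a pair fails.  Otherwise such pairs are also excluded, and the search
-- started from a pair with 3 agreements and 1 disagreement ends only in families isomorphic to E or F.
module Submission where

open import Defs
open import Data.Bool using (Bool; true; false; not; T; T?; _∧_; _∨_; if_then_else_) renaming (_≟_ to _≟ᵇ_)
open import Data.Bool.ListAction using (any; all)
open import Data.Bool.Properties using (not-involutive; T-≡)
open import Data.Empty using (⊥-elim)
open import Data.Fin using (Fin; zero; suc)
open import Data.Fin.Properties using (any?) renaming (_≟_ to _≟ᶠ_)
open import Data.Fin.Subset using (Subset) renaming (_∈_ to _∈ₛ_)
open import Data.Integer using (ℤ; +_; -[1+_]; 0ℤ; 1ℤ; _+_; _*_; -_; _≤_; _<_; +≤+; +<+; -<+)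
open import Data.Integer.Properties
open import Data.Integer.Tactic.RingSolver using (solve-∀)
open import Data.List using (List; []; _∷_; _++_; length; tabulate; allFin; map; filterᵇ; concatMap; zip; replicate; drop)
open import Data.List.Membership.DecPropositional (_≟ᶠ_ {8}) using (_∈?_)
open import Data.List.Membership.Propositional using (find; lose) renaming (_∈_ to _∈ₗ_)
open import Data.List.Membership.Propositional.Properties
  using (∈-∃++; ∈-++⁺ˡ; ∈-++⁺ʳ; ∈-++⁻; ∈-map⁺; ∈-map⁻; ∈-filter⁺; ∈-filter⁻; ∈-allFin; ∈-concatMap⁺; ∈-concatMap⁻)
open import Data.List.Properties using (map-tabulate; map-∘; length-++; length-map; map-++; ++-assoc)
open import Data.List.Relation.Binary.Permutation.Propositional as Perm using (_↭_; ↭-sym; ↭-trans; ↭⇒↭ₛ)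
open import Data.List.Relation.Binary.Permutation.Propositional.Properties using (∈-resp-↭; shift; ++⁺ˡ; ↭-length)
import Data.List.Relation.Binary.Permutation.Setoid.Properties as Permₛ
open import Data.List.Relation.Unary.All as All using (All; []; _∷_)
open import Data.List.Relation.Unary.Any as Any using (Any; here; there)
open import Data.List.Relation.Unary.Unique.DecPropositional (_≟ᶠ_ {8}) using (unique?)
open import Data.List.Relation.Unary.Unique.Propositional using (Unique; []; _∷_)
open import Data.List.Relation.Unary.Unique.Propositional.Properties using (allFin⁺)
open import Data.Nat as ℕ using (ℕ; zero; suc; _∸_; _^_; _≥_; _<ᵇ_; _≡ᵇ_)
import Data.Nat.Properties as ℕₚ
open import Data.Product using (∃; _×_; _,_; proj₁; proj₂)
open import Data.Sum using (_⊎_; inj₁; inj₂)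
open import Data.Vec as Vec using ([]; _∷_; lookup; zipWith; _[_]≔_)
open import Data.Vec.Properties using (lookup-map; lookup∘update; lookup∘update′; []=⇒lookup; lookup⇒[]=)
open import Function using (_∘_; id)
open import Function.Bundles using (Equivalence; mk⇔)
open import Relation.Binary.PropositionalEquality
open import Relation.Nullary using (¬_; Dec; yes; no; does; _×-dec_)

-- The obstacle is that `n` is unbounded while the search has to be finite. Coordinates are
-- therefore labelled only when a chosen face fixes them: chosen faces are then known completely,
-- every other face only by its restriction to the labels, and reordering and reflecting coordinates
-- removes all choice from a new label. Four-element Q are the useful ones because their even size
-- gives a face and its antipode the same sign; for odd Q the two signs cancel and the identity says
-- nothing beyond that. One representative of each antipodal pair is enough, so a complete family
-- has 16 members. Two searches are run because forbidding the 2 + 2 pairs is legitimate only after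
-- the case where such a pair exists has been settled. A pair with 3 + 1 then exists: freeing one
-- fixed coordinate of a face leaves a set Q of size 4 on which another face has to cancel it, so
-- some pair shares exactly four coordinates, and passing to an antipode exchanges 3 + 1 with 1 + 3.

private variable
  X Y : Set
  n : ℕ

-- Search over families of sign patterns

-- A pattern restricts a face to the labelled coordinates, newest first.  A clause is a list of
-- patterns one of which, up to a global sign, comes from a face not chosen yet.
Pattern Clause : Set
Pattern = List Entry
Clause  = List Pattern

fixedCount : Pattern → ℕ
fixedCount []          = 0
fixedCount (fix _ ∷ u) = suc (fixedCount u)
fixedCount (star  ∷ u) = fixedCount u

-- The continuation `k` receives the numbers of agreements and disagreements, so that one traversal
-- serves both `compatible` and `sameSupport`.
compare : (ℕ → ℕ → Bool) → Pattern → Pattern → ℕ → ℕ → Bool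
compare k (fix true ∷ u)  (fix true ∷ w)  a d = compare k u w (suc a) d
compare k (fix false ∷ u) (fix false ∷ w) a d = compare k u w (suc a) d
compare k (fix true ∷ u)  (fix false ∷ w) a d = compare k u w a (suc d)
compare k (fix false ∷ u) (fix true ∷ w)  a d = compare k u w a (suc d)
compare k (_ ∷ u)         (_ ∷ w)         a d = compare k u w a d
compare k _               _               a d = k a d

-- strict also forbids two agreements together with two disagreements.
admissible : Bool → ℕ → ℕ → Bool
admissible strict zero    d       = false
admissible strict (suc a) zero    = false
admissible strict (suc a) (suc d) = (a ℕ.+ d <ᵇ 3) ∧ not (strict ∧ (a ≡ᵇ 1) ∧ (d ≡ᵇ 1))

compatible : Bool → Pattern → Pattern → Bool
compatible strict u w = compare (admissible strict) u w 0 0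

-- Meaningful for the restrictions of two faces with 5 fixed coordinates, one of them fully labelled.
sameSupport : Pattern → Pattern → Bool
sameSupport u w = compare (λ a d → 4 <ᵇ a ℕ.+ d) u w 0 0

-- The first pattern stands for Q, its fixed coordinates, and for a reference sign vector on Q. The
-- value is χ_Q of the second pattern times the sign of the reference, hence 1 on every extension of
-- the reference.
sign : Pattern → Pattern → ℤ
sign (fix true ∷ u)  (fix true ∷ w)  = sign u w
sign (fix false ∷ u) (fix false ∷ w) = sign u w
sign (fix true ∷ u)  (fix false ∷ w) = - sign u w
sign (fix false ∷ u) (fix true ∷ w)  = - sign u w
sign (fix _ ∷ u)     (star ∷ w)      = + 0
sign (star ∷ u)      (_ ∷ w)         = sign u w
sign _               _               = + 1

signSum : Pattern → List Pattern → ℤ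
signSum p []       = + 0
signSum p (w ∷ ws) = sign p w + signSum p ws

isPositive isNegative : ℤ → Bool
isPositive (+ suc _) = true
isPositive _         = false
isNegative -[1+ _ ]  = true
isNegative _         = false

-- For a chosen face these are its restrictions to the five 4-element subsets of its support, the
-- sets Q on which cancellation is demanded.
drops : Pattern → List Pattern
drops []          = []
drops (star ∷ u)  = map (star ∷_) (drops u)
drops (fix b ∷ u) = (star ∷ u) ∷ map (fix b ∷_) (drops u)

-- `bl` holds one face of each chosen antipodal pair. For |Q| = 4 the antipodes double the sum over
-- `bl`, so the remaining faces must sum to the opposite sign and one of them has that sign. A zero
-- sum forces nothing, hence a list of at most one clause.
clauseFor : List Pattern → Clause → Pattern → List Clause
clauseFor bl pool p with signSum p bl
... | + 0      = []
... | + suc _  = filterᵇ (λ x → isNegative (sign p x)) pool ∷ []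
... | -[1+ _ ] = filterᵇ (λ x → isPositive (sign p x)) pool ∷ []

newClauses : List Pattern → Clause → Pattern → List Clause
newClauses bl pool u = concatMap (clauseFor bl pool) (drops u)

prune : Bool → Pattern → Clause → Clause
prune strict u = filterᵇ (λ x → compatible strict x u)

-- A clause containing a pattern with the support of the new face may just have been fulfilled by it
-- and is discarded. Discarding only loses information, and the clauses on the 4-subsets of the new
-- face are recomputed.
isOpen : Pattern → Clause → Bool
isOpen u c = not (any (λ x → sameSupport x u) c)

-- Lists the possible entries at a new coordinate: a face has only 5 fixed entries, and the global
-- sign is normalised by making the first one true.
extendPattern : Pattern → List Pattern
extendPattern u with fixedCount u
... | 0 = (star ∷ u) ∷ (fix true ∷ u) ∷ []
... | suc (suc (suc (suc (suc _)))) = (star ∷ u) ∷ []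
... | _ = (star ∷ u) ∷ (fix true ∷ u) ∷ (fix false ∷ u) ∷ []

extend : Clause → Clause
extend = concatMap extendPattern

shorter : Clause → Clause → Bool
shorter []       _        = true
shorter (_ ∷ _)  []       = false
shorter (_ ∷ xs) (_ ∷ ys) = shorter xs ys

shortest : Clause → List Clause → Clause
-- An empty clause is already a contradiction, so the others need not be examined.
shortest []       _        = []
shortest c        []       = c
shortest c@(_ ∷ _) (d ∷ ds) = if shorter c d then shortest c ds else shortest d ds

-- The pool contains, up to a global sign, the pattern of every face not chosen yet.
record State : Set where
  constructor state
  field
    blocks  : List Pattern
    pool    : Clause
    clauses : List Clause

-- The new face leaves the pool without explicit removal: it has no disagreement with itself and no
-- agreement with its antipode, so `prune` rejects both.
addBlock : Bool → Pattern → State → State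
addBlock strict u (state bl pool cs) = state (u ∷ bl) pool′
    (newClauses (u ∷ bl) pool′ u ++ map (prune strict u) (filterᵇ (isOpen u) cs))
  where pool′ = prune strict u pool

-- Chosen faces receive a star, because a face is chosen only after all its five fixed coordinates
-- have been labelled.
addCoordinate : State → State
addCoordinate (state bl pool cs) = state (map (star ∷_) bl) (extend pool) (map extend cs)

module _ (leaf : List Pattern → Bool) (strict : Bool) where
  search : ℕ → State → Bool
  branch : ℕ → State → Clause → Bool
  place  : ℕ → ℕ → State → Pattern → Bool

  -- Without a clause the family chosen so far may be incomplete; then every remaining face is tried.
  search zero    s                       = false
  search (suc f) s@(state bl pool (c ∷ cs)) = branch f s (shortest c cs)
  search (suc f) s@(state bl pool [])       = if length bl ≡ᵇ 16 then leaf bl else branch f s pool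

  -- Some listed pattern would have to come from a remaining face; with none listed the situation is
  -- contradictory and the branch is closed.
  branch f s []       = true
  branch f s (u ∷ us) = place f (5 ∸ fixedCount u) s u ∧ branch f s us

  place f zero    s u = search f (addBlock strict u s)
  -- The fixed coordinates still unlabelled lie outside every chosen face, so their order is
  -- immaterial, and a reflection makes the entry `true`.
  place f (suc k) s u = place f k (addCoordinate s) (fix true ∷ u)

-- Isomorphism with a listed family of blocks

incidence : ∀ {m} → List (Subset m) → Fin m → List Bool
incidence T t = map (λ S → lookup S t) T

meets : List Bool → List Bool → ℕ
meets (true ∷ xs) (true ∷ ys) = suc (meets xs ys)
meets (_ ∷ xs)    (_ ∷ ys)    = meets xs ys
meets _           _           = 0

fixedHead : Pattern → Bool
fixedHead (e ∷ _) = isFixed e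
fixedHead []      = false

columns : ℕ → List Pattern → List (List Bool)
columns zero    bl = []
columns (suc k) bl = map fixedHead bl ∷ columns k (map (drop 1) bl)

Labelling : Set
Labelling = List (Fin 8)

PartialLabelling : Set
PartialLabelling = List (List Bool × Fin 8)

consistent : (Fin 8 → List Bool) → List Bool × Fin 8 → PartialLabelling → Bool
consistent col (c , t) = all (λ (c′ , t′) → meets c c′ ≡ᵇ meets (col t) (col t′))

assign : (Fin 8 → List Bool) → List Bool → PartialLabelling → List PartialLabelling
assign col c ls = filterᵇ (λ { [] → false ; (l ∷ ls) → consistent col l (l ∷ ls) }) (map (λ t → (c , t) ∷ ls)
    (allFin 8))

-- Proposes isomorphisms by matching pairwise intersection numbers; only certifies is trusted.
labellings : (Fin 8 → List Bool) → List (List Bool) → List PartialLabelling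
labellings col []       = [] ∷ []
labellings col (c ∷ cs) = concatMap (assign col c) (labellings col cs)

matches : Labelling → Pattern → Subset 8 → Bool
matches []      []          S = true
matches (t ∷ τ) (fix _ ∷ u) S = if lookup S t then matches τ u S else false
matches (t ∷ τ) (star ∷ u)  S = if lookup S t then false else matches τ u S
matches _       _           S = false

-- `τ` sends the labelled coordinates, in order, to points of `Fin 8`. The first two tests make it a
-- bijection, the last two make faces and members of `T` correspond; equality of lengths is enforced
-- by `matches`.
certifies : List (Subset 8) → List Pattern → Labelling → Bool
certifies T bl τ =
  (does (unique? τ) ∧ all (λ t → does (t ∈? τ)) (allFin 8))
  ∧ (all (λ u → any (matches τ u) T) bl ∧ all (λ S → any (λ u → matches τ u S) bl) T)

isomorphic : List (Subset 8) → List Pattern → Bool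
isomorphic T bl = any (λ ls → certifies T bl (map proj₂ ls)) (labellings (incidence T) (columns 8 bl))

leaf : List Pattern → Bool
leaf bl = isomorphic Elist bl ∨ isomorphic Flist bl

poolOf : ℕ → Clause
poolOf zero    = [] ∷ []
poolOf (suc k) = extend (poolOf k)

-- Two faces with five fixed coordinates each, four of them common, occupy 5 + 5 - 4 = 6
-- coordinates.
start : Bool → Pattern → Pattern → State
start strict b c = addBlock strict c (addBlock strict b (state [] (poolOf 6) []))

-- Sums over lists and over the cube

sumOver : (X → ℤ) → List X → ℤ
sumOver f []       = 0ℤ
sumOver f (x ∷ xs) = f x + sumOver f xs

sumOver-cong : {f g : X → ℤ} (xs : List X) → (∀ x → x ∈ₗ xs → f x ≡ g x) → sumOver f xs ≡ sumOver g xs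
sumOver-cong []       h = refl
sumOver-cong (x ∷ xs) h = cong₂ _+_ (h x (here refl)) (sumOver-cong xs (λ y → h y ∘ there))

sumOver-*ʳ : (f : X → ℤ) (c : ℤ) (xs : List X) → sumOver (λ x → f x * c) xs ≡ sumOver f xs * c
sumOver-*ʳ f c []       = refl
sumOver-*ʳ f c (x ∷ xs) = trans (cong (_+_ (f x * c)) (sumOver-*ʳ f c xs)) (sym (*-distribʳ-+ c (f x) _))

sumOver-*ˡ : (f : X → ℤ) (c : ℤ) (xs : List X) → sumOver (λ x → c * f x) xs ≡ c * sumOver f xs
sumOver-*ˡ f c []       = sym (*-zeroʳ c)
sumOver-*ˡ f c (x ∷ xs) = trans (cong (_+_ (c * f x)) (sumOver-*ˡ f c xs)) (sym (*-distribˡ-+ c (f x) _))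

sumOver-const : (c : ℤ) (xs : List X) → sumOver (λ _ → c) xs ≡ + length xs * c
sumOver-const c []       = refl
sumOver-const c (x ∷ xs) = trans (cong (_+_ c) (sumOver-const c xs)) (sym (suc-* (+ length xs) c))

sumOver-nonneg : {f : X → ℤ} (xs : List X) → (∀ x → x ∈ₗ xs → 0ℤ ≤ f x) → 0ℤ ≤ sumOver f xs
sumOver-nonneg []       h = ≤-refl
sumOver-nonneg (x ∷ xs) h = +-mono-≤ (h x (here refl)) (sumOver-nonneg xs (λ y → h y ∘ there))

head≤sumOver : {f : X → ℤ} (x : X) (xs : List X) → (∀ y → y ∈ₗ xs → 0ℤ ≤ f y) → f x ≤ f x + sumOver f xs
head≤sumOver {f = f} x xs h = subst (_≤ f x + sumOver f xs) (+-identityʳ (f x)) (+-monoʳ-≤ (f x) (sumOver-nonneg xs h))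

tail≤sumOver : {f : X → ℤ} (x : X) (xs : List X) → 0ℤ ≤ f x → sumOver f xs ≤ f x + sumOver f xs
tail≤sumOver {f = f} x xs h = subst (_≤ f x + sumOver f xs) (+-identityˡ (sumOver f xs)) (+-monoˡ-≤ (sumOver f xs) h)

term≤sumOver : {f : X → ℤ} {x : X} {xs : List X} → (∀ y → y ∈ₗ xs → 0ℤ ≤ f y) → x ∈ₗ xs → f x ≤ sumOver f xs
term≤sumOver {xs = y ∷ ys} h (here refl) = head≤sumOver y ys (λ z → h z ∘ there)
term≤sumOver {xs = y ∷ ys} h (there x∈)  = ≤-trans (term≤sumOver (λ z → h z ∘ there) x∈) (tail≤sumOver y ys
    (h y (here refl)))

twoTerms≤sumOver : {f : X → ℤ} {x y : X} {xs : List X} → (∀ z → z ∈ₗ xs → 0ℤ ≤ f z) →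
  x ∈ₗ xs → y ∈ₗ xs → x ≢ y → f x + f y ≤ sumOver f xs
twoTerms≤sumOver h (here refl) (here refl) x≢y = ⊥-elim (x≢y refl)
twoTerms≤sumOver {f = f} {x} h (here refl) (there y∈) _ = +-monoʳ-≤ (f x) (term≤sumOver (λ z → h z ∘ there) y∈)
twoTerms≤sumOver {f = f} {x} {y} {xs = _ ∷ xs} h (there x∈) (here refl) _ =
  subst (_≤ f y + sumOver f xs) (+-comm (f y) (f x)) (+-monoʳ-≤ (f y) (term≤sumOver (λ z → h z ∘ there) x∈))
twoTerms≤sumOver {xs = z ∷ zs} h (there x∈) (there y∈) x≢y =
  ≤-trans (twoTerms≤sumOver (λ w → h w ∘ there) x∈ y∈ x≢y) (tail≤sumOver z zs (h z (here refl)))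

negativeTerm : {f : X → ℤ} (xs : List X) → sumOver f xs < 0ℤ → ∃ λ x → x ∈ₗ xs × f x < 0ℤ
negativeTerm []       (+<+ ())
negativeTerm {f = f} (x ∷ xs) s<0 with f x <? 0ℤ
... | yes fx<0 = x , here refl , fx<0
... | no  fx≮0 with negativeTerm xs (≤-<-trans (tail≤sumOver {f = f} x xs (≮⇒≥ fx≮0)) s<0)
...   | y , y∈ , fy<0 = y , there y∈ , fy<0

sumOver-neg : (f : X → ℤ) (xs : List X) → sumOver (λ x → - f x) xs ≡ - sumOver f xs
sumOver-neg f []       = refl
sumOver-neg f (x ∷ xs) = trans (cong (_+_ (- f x)) (sumOver-neg f xs)) (sym (neg-distrib-+ (f x) _))

positiveTerm : {f : X → ℤ} (xs : List X) → 0ℤ < sumOver f xs → ∃ λ x → x ∈ₗ xs × 0ℤ < f x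
positiveTerm {f = f} xs 0<s
  with negativeTerm {f = λ x → - f x} xs (subst (_< 0ℤ) (sym (sumOver-neg f xs)) (neg-mono-< 0<s))
... | x , x∈ , -fx<0 = x , x∈ , subst (0ℤ <_) (neg-involutive (f x)) (neg-mono-< -fx<0)

cubeSum : ∀ n → (Vertex n → ℤ) → ℤ
cubeSum zero    f = f []
cubeSum (suc n) f = cubeSum n (f ∘ (true ∷_)) + cubeSum n (f ∘ (false ∷_))

cubeSum-cong : ∀ n {f g : Vertex n → ℤ} → (∀ x → f x ≡ g x) → cubeSum n f ≡ cubeSum n g
cubeSum-cong zero    h = h []
cubeSum-cong (suc n) h = cong₂ _+_ (cubeSum-cong n (h ∘ (true ∷_))) (cubeSum-cong n (h ∘ (false ∷_)))

cubeSum-+ : ∀ n (f g : Vertex n → ℤ) → cubeSum n (λ x → f x + g x) ≡ cubeSum n f + cubeSum n g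
cubeSum-+ zero    f g = refl
cubeSum-+ (suc n) f g = trans (cong₂ _+_ (cubeSum-+ n (f ∘ (true ∷_)) (g ∘ (true ∷_)))
    (cubeSum-+ n (f ∘ (false ∷_)) (g ∘ (false ∷_))))
  (interchange (cubeSum n (f ∘ (true ∷_))) (cubeSum n (g ∘ (true ∷_))) (cubeSum n (f ∘ (false ∷_)))
      (cubeSum n (g ∘ (false ∷_))))
  where
  interchange : ∀ a b c d → (a + b) + (c + d) ≡ (a + c) + (b + d)
  interchange = solve-∀

cubeSum-*ˡ : ∀ n (c : ℤ) (f : Vertex n → ℤ) → cubeSum n (λ x → c * f x) ≡ c * cubeSum n f
cubeSum-*ˡ zero    c f = refl
cubeSum-*ˡ (suc n) c f = trans (cong₂ _+_ (cubeSum-*ˡ n c _) (cubeSum-*ˡ n c _)) (sym (*-distribˡ-+ c _ _))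

cubeSum-0 : ∀ n → cubeSum n (λ _ → 0ℤ) ≡ 0ℤ
cubeSum-0 zero    = refl
cubeSum-0 (suc n) = cong₂ _+_ (cubeSum-0 n) (cubeSum-0 n)

cubeSum-1 : ∀ n → cubeSum n (λ _ → 1ℤ) ≡ + (2 ^ n)
cubeSum-1 zero    = refl
cubeSum-1 (suc n) = trans (cong₂ _+_ (cubeSum-1 n) (cubeSum-1 n)) (cong (λ k → + (2 ^ n ℕ.+ k))
    (sym (ℕₚ.+-identityʳ (2 ^ n))))

cubeSum-nonneg : ∀ n {f : Vertex n → ℤ} → (∀ x → 0ℤ ≤ f x) → 0ℤ ≤ cubeSum n f
cubeSum-nonneg zero    h = h []
cubeSum-nonneg (suc n) h = +-mono-≤ (cubeSum-nonneg n (h ∘ (true ∷_))) (cubeSum-nonneg n (h ∘ (false ∷_)))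

cubeSum-null : ∀ n {f : Vertex n → ℤ} → (∀ x → 0ℤ ≤ f x) → cubeSum n f ≡ 0ℤ → ∀ x → f x ≡ 0ℤ
cubeSum-null zero    h s≡0 [] = s≡0
cubeSum-null (suc n) {f} h s≡0 (true ∷ x) = cubeSum-null n (h ∘ (true ∷_)) (≤-antisym left≤0 (cubeSum-nonneg n
    (h ∘ (true ∷_)))) x
  where
  left≤0 : cubeSum n (f ∘ (true ∷_)) ≤ 0ℤ
  left≤0 = subst₂ _≤_ (+-identityʳ _) s≡0 (+-monoʳ-≤ (cubeSum n (f ∘ (true ∷_))) (cubeSum-nonneg n (h ∘ (false ∷_))))
cubeSum-null (suc n) {f} h s≡0 (false ∷ x) = cubeSum-null n (h ∘ (false ∷_)) (≤-antisym right≤0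
    (cubeSum-nonneg n (h ∘ (false ∷_)))) x
  where
  right≤0 : cubeSum n (f ∘ (false ∷_)) ≤ 0ℤ
  right≤0 = subst₂ _≤_ (+-identityˡ _) s≡0 (+-monoˡ-≤ (cubeSum n (f ∘ (false ∷_))) (cubeSum-nonneg n (h ∘ (true ∷_))))

cubeSum-sumOver : ∀ n (g : X → Vertex n → ℤ) (xs : List X) →
  sumOver (λ a → cubeSum n (g a)) xs ≡ cubeSum n (λ x → sumOver (λ a → g a x) xs)
cubeSum-sumOver n g []       = sym (cubeSum-0 n)
cubeSum-sumOver n g (a ∷ xs) = trans (cong (_+_ (cubeSum n (g a))) (cubeSum-sumOver n g xs)) (sym (cubeSum-+ n _ _))

-- Fourier coefficients of faces

entryIndicator entryCharacter : Entry → Bool → ℤ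
entryIndicator star        _     = 1ℤ
entryIndicator (fix true)  true  = 1ℤ
entryIndicator (fix false) false = 1ℤ
entryIndicator (fix _)     _     = 0ℤ
entryCharacter star        _     = 1ℤ
entryCharacter (fix true)  true  = 1ℤ
entryCharacter (fix false) false = 1ℤ
entryCharacter (fix _)     _     = -[1+ 0 ]

entrySign : Entry → Entry → ℤ
entrySign star        _           = 1ℤ
entrySign (fix _)     star        = 0ℤ
entrySign (fix true)  (fix true)  = 1ℤ
entrySign (fix false) (fix false) = 1ℤ
entrySign (fix _)     (fix _)     = -[1+ 0 ]

-- `character p` is the Walsh function of the fixed set of `p`, with its sign normalised to be 1 on
-- the face `p`.
indicator character : Face n → Vertex n → ℤ
indicator []      []      = 1ℤ
indicator (e ∷ a) (b ∷ x) = entryIndicator e b * indicator a x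
character []      []      = 1ℤ
character (e ∷ p) (b ∷ x) = entryCharacter e b * character p x

faceSign : Face n → Face n → ℤ
faceSign []      []      = 1ℤ
faceSign (e ∷ p) (d ∷ a) = entrySign e d * faceSign p a

-- The sum factorises over coordinates. A coordinate fixed in `a` contributes the single sign
-- `entrySign e d`; a star of `a` contributes 2 where `p` has a star and 1 - 1 = 0 where `p` is
-- fixed.
cubeSum-face : (p a : Face n) → cubeSum n (λ x → character p x * indicator a x) ≡ faceSign p a * + (2 ^ stars a)
cubeSum-face []      []      = refl
cubeSum-face {suc n} (e ∷ p) (d ∷ a) = trans (cong₂ _+_ (half true) (half false)) (combine e d)
  where
  regroup : ∀ a b c d → (a * b) * (c * d) ≡ (a * c) * (b * d)
  regroup = solve-∀
  S = faceSign p a * + (2 ^ stars a)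
  half : ∀ b → cubeSum n (λ x → (entryCharacter e b * character p x) * (entryIndicator d b * indicator a x))
             ≡ (entryCharacter e b * entryIndicator d b) * S
  half b = trans (cubeSum-cong n (λ x → regroup (entryCharacter e b) (character p x) (entryIndicator d b)
      (indicator a x)))
          (trans (cubeSum-*ˡ n (entryCharacter e b * entryIndicator d b) _)
                 (cong ((entryCharacter e b * entryIndicator d b) *_) (cubeSum-face p a)))
  double : + (2 ^ suc (stars a)) ≡ + 2 * + (2 ^ stars a)
  double = pos-* 2 (2 ^ stars a)
  one : ∀ s t → 1ℤ * (s * t) + 0ℤ * (s * t) ≡ (1ℤ * s) * t
  one = solve-∀
  one' : ∀ s t → 0ℤ * (s * t) + 1ℤ * (s * t) ≡ (1ℤ * s) * t
  one' = solve-∀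
  two : ∀ s t → 1ℤ * (s * t) + 1ℤ * (s * t) ≡ (1ℤ * s) * (+ 2 * t)
  two = solve-∀
  cancel : ∀ s t u → 1ℤ * (s * t) + -[1+ 0 ] * (s * t) ≡ (0ℤ * s) * u
  cancel = solve-∀
  cancel' : ∀ s t u → -[1+ 0 ] * (s * t) + 1ℤ * (s * t) ≡ (0ℤ * s) * u
  cancel' = solve-∀
  minus : ∀ s t → 0ℤ * (s * t) + -[1+ 0 ] * (s * t) ≡ (-[1+ 0 ] * s) * t
  minus = solve-∀
  minus' : ∀ s t → -[1+ 0 ] * (s * t) + 0ℤ * (s * t) ≡ (-[1+ 0 ] * s) * t
  minus' = solve-∀
  s₀ = faceSign p a
  t₀ = + (2 ^ stars a)
  combine : ∀ e d → (entryCharacter e true * entryIndicator d true) * S +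
      (entryCharacter e false * entryIndicator d false) * S
              ≡ (entrySign e d * faceSign p a) * + (2 ^ stars (d ∷ a))
  combine star        star        = trans (two s₀ t₀) (cong (_*_ (1ℤ * s₀)) (sym double))
  combine star        (fix true)  = one s₀ t₀
  combine star        (fix false) = one' s₀ t₀
  combine (fix true)  star        = cancel s₀ t₀ (+ (2 ^ suc (stars a)))
  combine (fix false) star        = cancel' s₀ t₀ (+ (2 ^ suc (stars a)))
  combine (fix true)  (fix true)  = one s₀ t₀
  combine (fix true)  (fix false) = minus s₀ t₀
  combine (fix false) (fix true)  = minus' s₀ t₀
  combine (fix false) (fix false) = one' s₀ t₀

allStar : ∀ n → Face n
allStar zero    = []
allStar (suc n) = star ∷ allStar n

faceSign-allStar : (a : Face n) → faceSign (allStar n) a ≡ 1ℤ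
faceSign-allStar []      = refl
faceSign-allStar (_ ∷ a) = trans (*-identityˡ _) (faceSign-allStar a)

character-allStar : (x : Vertex n) → character (allStar n) x ≡ 1ℤ
character-allStar []      = refl
character-allStar (_ ∷ x) = trans (*-identityˡ _) (character-allStar x)

-- Orthogonality to constants: the two halves of the cube in direction `i` cancel.
cubeSum-character : (p : Face n) (i : Fin n) → isFixed (lookup p i) ≡ true → cubeSum n (character p) ≡ 0ℤ
cubeSum-character {suc n} (e ∷ p) zero fixed =
  trans (cong₂ _+_ (cubeSum-*ˡ n (entryCharacter e true) _) (cubeSum-*ˡ n (entryCharacter e false) _)) (cancel e fixed)
  where
  pm : ∀ s → 1ℤ * s + -[1+ 0 ] * s ≡ 0ℤ
  pm = solve-∀
  mp : ∀ s → -[1+ 0 ] * s + 1ℤ * s ≡ 0ℤ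
  mp = solve-∀
  cancel : ∀ e → isFixed e ≡ true → entryCharacter e true * cubeSum n
      (character p) + entryCharacter e false * cubeSum n (character p) ≡ 0ℤ
  cancel (fix true)  _ = pm (cubeSum n (character p))
  cancel (fix false) _ = mp (cubeSum n (character p))
cubeSum-character {suc n} (e ∷ p) (suc i) fixed =
  cong₂ _+_ (zeroHalf true) (zeroHalf false)
  where
  zeroHalf : ∀ b → cubeSum n (λ x → entryCharacter e b * character p x) ≡ 0ℤ
  zeroHalf b = trans (cubeSum-*ˡ n (entryCharacter e b) _)
              (trans (cong (entryCharacter e b *_) (cubeSum-character p i fixed)) (*-zeroʳ (entryCharacter e b)))

indicator-nonneg : (a : Face n) (x : Vertex n) → 0ℤ ≤ indicator a x
indicator-nonneg []      []      = +≤+ ℕ.z≤n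
indicator-nonneg (star ∷ a)      (b ∷ x)     = subst (0ℤ ≤_) (sym (*-identityˡ _)) (indicator-nonneg a x)
indicator-nonneg (fix true ∷ a)  (true ∷ x)  = subst (0ℤ ≤_) (sym (*-identityˡ _)) (indicator-nonneg a x)
indicator-nonneg (fix false ∷ a) (false ∷ x) = subst (0ℤ ≤_) (sym (*-identityˡ _)) (indicator-nonneg a x)
indicator-nonneg (fix true ∷ a)  (false ∷ x) = ≤-refl
indicator-nonneg (fix false ∷ a) (true ∷ x)  = ≤-refl

indicator-∈F : (a : Face n) (x : Vertex n) → x ∈F a → indicator a x ≡ 1ℤ
indicator-∈F []      []      _  = refl
indicator-∈F (star ∷ a)  (b ∷ x) x∈a = trans (*-identityˡ _) (indicator-∈F a x (x∈a ∘ suc))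
indicator-∈F (fix c ∷ a) (b ∷ x) x∈a with x∈a zero c refl
indicator-∈F (fix true ∷ a)  (_ ∷ x) x∈a | refl = trans (*-identityˡ _) (indicator-∈F a x (x∈a ∘ suc))
indicator-∈F (fix false ∷ a) (_ ∷ x) x∈a | refl = trans (*-identityˡ _) (indicator-∈F a x (x∈a ∘ suc))

agreeing disagreeing : Entry → Entry → Bool
agreeing (fix true)  (fix true)  = true
agreeing (fix false) (fix false) = true
agreeing _           _           = false
disagreeing (fix true)  (fix false) = true
disagreeing (fix false) (fix true)  = true
disagreeing _           _           = false

commonVertex : Face n → Face n → Vertex n
commonVertex = zipWith pick
  where
  pick : Entry → Entry → Bool
  pick (fix b) _       = b
  pick star    (fix b) = b
  pick star    star    = true

commonVertex-∈ˡ : (a b : Face n) → commonVertex a b ∈F a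
commonVertex-∈ˡ (fix c ∷ a) (_ ∷ b) zero    c refl = refl
commonVertex-∈ˡ (_ ∷ a)     (_ ∷ b) (suc i) c e    = commonVertex-∈ˡ a b i c e

commonVertex-∈ʳ : (a b : Face n) → (∀ i → disagreeing (lookup a i) (lookup b i) ≡ false) → commonVertex a b ∈F b
commonVertex-∈ʳ (star ∷ a)      (fix c ∷ b)     h zero    c refl = refl
commonVertex-∈ʳ (fix true ∷ a)  (fix true ∷ b)  h zero    _ refl = refl
commonVertex-∈ʳ (fix false ∷ a) (fix false ∷ b) h zero    _ refl = refl
commonVertex-∈ʳ (fix true ∷ a)  (fix false ∷ b) h zero    _ refl = h zero
commonVertex-∈ʳ (fix false ∷ a) (fix true ∷ b)  h zero    _ refl = sym (h zero)
commonVertex-∈ʳ (_ ∷ a)         (_ ∷ b)         h (suc i) c e    = commonVertex-∈ʳ a b (h ∘ suc) i c e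

-- The faces of a splitting partition the cube

totalVolume : ∀ l k {n} → l ≡ 2 ^ k → n ≥ k → + l * + (2 ^ (n ∸ k)) ≡ + (2 ^ n)
totalVolume l k {n} refl n≥k =
  trans (sym (pos-* (2 ^ k) (2 ^ (n ∸ k))))
        (cong +_ (trans (sym (ℕₚ.^-distribˡ-+-* 2 k (n ∸ k))) (cong (2 ^_) (ℕₚ.m+[n∸m]≡n n≥k))))

module Partition {n : ℕ} (n≥5 : n ≥ 5) {A : List (Face n)} (S : AntipodalSplitting n 5 A) where
  open AntipodalSplitting S

  cover : Vertex n → ℤ
  cover x = sumOver (λ a → indicator a x) A

  -- By `dim` all faces have the same volume, so it comes out of the sum of their coefficients; the
  -- rest is an exchange of summations.
  faceSum : (p : Face n) → sumOver (λ a → faceSign p a) A * + (2 ^ (n ∸ 5)) ≡ cubeSum n (λ x → character p x * cover x)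
  faceSum p = begin
    sumOver (faceSign p) A * + (2 ^ (n ∸ 5))
      ≡⟨ sym (sumOver-*ʳ (faceSign p) (+ (2 ^ (n ∸ 5))) A) ⟩
    sumOver (λ a → faceSign p a * + (2 ^ (n ∸ 5))) A
      ≡⟨ sumOver-cong A (λ a a∈ → trans (cong (λ k → faceSign p a * + (2 ^ k)) (sym (dim a a∈)))
          (sym (cubeSum-face p a))) ⟩
    sumOver (λ a → cubeSum n (λ x → character p x * indicator a x)) A
      ≡⟨ cubeSum-sumOver n _ A ⟩
    cubeSum n (λ x → sumOver (λ a → character p x * indicator a x) A)
      ≡⟨ cubeSum-cong n (λ x → sumOver-*ˡ (λ a → indicator a x) (character p x) A) ⟩
    cubeSum n (λ x → character p x * cover x) ∎
    where open ≡-Reasoning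

  cubeSum-cover : cubeSum n cover ≡ + (2 ^ n)
  cubeSum-cover = begin
    cubeSum n cover
      ≡⟨ cubeSum-cong n (λ x → sym (trans (cong (_* cover x) (character-allStar x)) (*-identityˡ _))) ⟩
    cubeSum n (λ x → character (allStar n) x * cover x)
      ≡⟨ sym (faceSum (allStar n)) ⟩
    sumOver (faceSign (allStar n)) A * + (2 ^ (n ∸ 5))
      ≡⟨ cong (_* + (2 ^ (n ∸ 5))) (trans (sumOver-cong A (λ a _ → faceSign-allStar a))
          (trans (sumOver-const 1ℤ A) (*-identityʳ (+ length A)))) ⟩
    + length A * + (2 ^ (n ∸ 5))
      ≡⟨ totalVolume (length A) 5 size n≥5 ⟩
    + (2 ^ n) ∎
    where open ≡-Reasoning

  1≤cover : ∀ x → 1ℤ ≤ cover x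
  1≤cover x with covers x
  ... | a , a∈ , x∈a = subst (_≤ cover x) (indicator-∈F a x x∈a) (term≤sumOver (λ b _ → indicator-nonneg b x) a∈)

  -- `cover` is at least 1 everywhere and has average 1 by the volume count; a nonnegative excess
  -- with sum 0 vanishes.
  cover≡1 : ∀ x → cover x ≡ 1ℤ
  cover≡1 x = i-j≡0⇒i≡j (cover x) 1ℤ (cubeSum-null n (λ y → i≤j⇒0≤j-i (1≤cover y)) excess≡0 x)
    where
    excess≡0 : cubeSum n (λ y → cover y + -[1+ 0 ]) ≡ 0ℤ
    excess≡0 = trans (cubeSum-+ n cover (λ _ → -[1+ 0 ])) (trans (cong₂ _+_ cubeSum-cover
      (trans (cubeSum-*ˡ n -[1+ 0 ] (λ _ → 1ℤ)) (cong (-[1+ 0 ] *_) (cubeSum-1 n)))) (cancel (+ (2 ^ n))))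
      where
      cancel : ∀ s → s + -[1+ 0 ] * s ≡ 0ℤ
      cancel = solve-∀

  abstract
    -- The constant function 1 has zero coefficient at a nonempty Q, and the common volume factor is
    -- a nonzero power of two.
    faceSign-sum : (p : Face n) (i : Fin n) → isFixed (lookup p i) ≡ true → sumOver (faceSign p) A ≡ 0ℤ
    faceSign-sum p i fixed with i*j≡0⇒i≡0∨j≡0 (sumOver (faceSign p) A) {+ (2 ^ (n ∸ 5))} zeroProduct
      where
      zeroProduct : sumOver (faceSign p) A * + (2 ^ (n ∸ 5)) ≡ 0ℤ
      zeroProduct = trans (faceSum p)
          (trans (cubeSum-cong n (λ x → trans (cong (character p x *_) (cover≡1 x)) (*-identityʳ _)))
          (cubeSum-character p i fixed))
    ... | inj₁ s≡0 = s≡0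
    ... | inj₂ 2^≡0 = ⊥-elim (ℕₚ.<⇒≢ (ℕₚ.m^n>0 2 (n ∸ 5)) (sym (+-injective 2^≡0)))

    -- Without a disagreement `commonVertex a b` would lie in both faces and be covered twice.
    disjoint : ∀ {a b} → a ∈ₗ A → b ∈ₗ A → a ≢ b → ∃ λ i → disagreeing (lookup a i) (lookup b i) ≡ true
    disjoint {a} {b} a∈ b∈ a≢b with any? (λ i → disagreeing (lookup a i) (lookup b i) ≟ᵇ true)
    ... | yes found = found
    ... | no  none  = ⊥-elim (<⇒≱ 1<2 (subst₂ _≤_ (cong₂ _+_ (indicator-∈F a x (commonVertex-∈ˡ a b))
        (indicator-∈F b x x∈b)) (cover≡1 x)
                         (twoTerms≤sumOver (λ c _ → indicator-nonneg c x) a∈ b∈ a≢b)))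
      where
      x : Vertex n
      x = commonVertex a b
      never : ∀ i → disagreeing (lookup a i) (lookup b i) ≡ false
      never i with disagreeing (lookup a i) (lookup b i) in eq
      ... | false = refl
      ... | true  = ⊥-elim (none (i , eq))
      x∈b : x ∈F b
      x∈b = commonVertex-∈ʳ a b never
      1<2 : 1ℤ < + 2
      1<2 = +<+ (ℕ.s≤s (ℕ.s≤s ℕ.z≤n))

-- Counting

count : (X → Bool) → List X → ℕ
count f []       = 0
count f (x ∷ xs) = if f x then suc (count f xs) else count f xs

count-++ : (f : X → Bool) (xs ys : List X) → count f (xs ++ ys) ≡ count f xs ℕ.+ count f ys
count-++ f []       ys = refl
count-++ f (x ∷ xs) ys with f x
... | true  = cong suc (count-++ f xs ys)
... | false = count-++ f xs ys

count-↭ : (f : X → Bool) {xs ys : List X} → xs ↭ ys → count f xs ≡ count f ys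
count-↭ f Perm.refl = refl
count-↭ f (Perm.prep x p) with f x
... | true  = cong suc (count-↭ f p)
... | false = count-↭ f p
count-↭ f (Perm.swap x y p) with f x | f y
... | true  | true  = cong (λ k → suc (suc k)) (count-↭ f p)
... | true  | false = cong suc (count-↭ f p)
... | false | true  = cong suc (count-↭ f p)
... | false | false = count-↭ f p
count-↭ f (Perm.trans p q) = trans (count-↭ f p) (count-↭ f q)

count-map : (f : Y → Bool) (g : X → Y) (xs : List X) → count f (map g xs) ≡ count (f ∘ g) xs
count-map f g []       = refl
count-map f g (x ∷ xs) with f (g x)
... | true  = cong suc (count-map f g xs)
... | false = count-map f g xs

count-cong : {f g : X → Bool} (xs : List X) → (∀ x → x ∈ₗ xs → f x ≡ g x) → count f xs ≡ count g xs
count-cong []       h = refl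
count-cong {g = g} (x ∷ xs) h rewrite h x (here refl) with g x
... | true  = cong suc (count-cong xs (λ y → h y ∘ there))
... | false = count-cong xs (λ y → h y ∘ there)

count-none : {f : X → Bool} (xs : List X) → (∀ x → x ∈ₗ xs → f x ≡ false) → count f xs ≡ 0
count-none []       h = refl
count-none (x ∷ xs) h rewrite h x (here refl) = count-none xs (λ y → h y ∘ there)

count-≤ : {f g : X → Bool} (xs : List X) → (∀ x → f x ≡ true → g x ≡ true) → count f xs ℕ.≤ count g xs
count-≤ []       h = ℕ.z≤n
count-≤ {f = f} {g} (x ∷ xs) h with f x in fx | g x in gx
... | true  | true  = ℕ.s≤s (count-≤ xs h)
... | false | true  = ℕₚ.m≤n⇒m≤1+n (count-≤ xs h)
... | false | false = count-≤ xs h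
... | true  | false with () ← trans (sym gx) (h x fx)

-- Pigeonhole principle, used for supports: an inclusion between two sets of five fixed coordinates
-- is an equality.
count-saturated : {f g : X → Bool} (xs : List X) → (∀ x → f x ≡ true → g x ≡ true) → count g xs ℕ.≤ count f xs →
  ∀ x → x ∈ₗ xs → g x ≡ true → f x ≡ true
count-saturated {f = f} {g} (x ∷ xs) h le y y∈ gy with f x in fx | g x in gx
count-saturated (x ∷ xs) h le y (here refl) gy | true  | _ = fx
count-saturated (x ∷ xs) h le y (there y∈) gy | true  | true  = count-saturated xs h (ℕₚ.≤-pred le) y y∈ gy
... | true | false with () ← trans (sym gx) (h x fx)
... | false | true  = ⊥-elim (ℕₚ.<⇒≱ le (count-≤ xs h))
count-saturated (x ∷ xs) h le y (here refl) gy | false | false with () ← trans (sym gx) gy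
count-saturated (x ∷ xs) h le y (there y∈) gy | false | false = count-saturated xs h le y y∈ gy

count-positive : {f : X → Bool} (xs : List X) → 0 ℕ.< count f xs → ∃ λ x → x ∈ₗ xs × f x ≡ true
count-positive {f = f} (x ∷ xs) 0<c with f x in fx
... | true  = x , here refl , fx
... | false with count-positive xs 0<c
...   | y , y∈ , fy = y , there y∈ , fy

positive-count : {f : X → Bool} {x : X} {xs : List X} → x ∈ₗ xs → f x ≡ true → 0 ℕ.< count f xs
positive-count (here refl) fx rewrite fx = ℕ.s≤s ℕ.z≤n
positive-count {f = f} {xs = y ∷ _} (there x∈) fx with f y
... | true  = ℕ.s≤s ℕ.z≤n
... | false = positive-count x∈ fx

-- The hypothesis adds the indicators pointwise, in a form that reduces to a false equation of
-- numerals when `f x` and `g x` both hold.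
count-+ : {f g h : X → Bool} (xs : List X) → (∀ x → (if f x then suc else id) ((if g x then 1 else 0)) ≡
    (if h x then 1 else 0)) →
  count f xs ℕ.+ count g xs ≡ count h xs
count-+ []       eq = refl
count-+ {f = f} {g} {h} (x ∷ xs) eq with f x | g x | h x | eq x
... | true  | false | true  | _ = cong suc (count-+ xs eq)
... | false | true  | true  | _ = trans (ℕₚ.+-suc _ _) (cong suc (count-+ xs eq))
... | false | false | false | _ = count-+ xs eq

count-punch : {f g : X → Bool} {i : X} {xs : List X} → Unique xs → i ∈ₗ xs → f i ≡ true → g i ≡ false →
  (∀ j → j ≢ i → f j ≡ g j) → count f xs ≡ suc (count g xs)
count-punch {xs = x ∷ xs} (x∉ ∷ u) (here refl) fi gi same rewrite fi | gi =
  cong suc (count-cong xs (λ j j∈ → same j (λ j≡x → All.lookup x∉ j∈ (sym j≡x))))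
count-punch {f = f} {g} {xs = x ∷ xs} (x∉ ∷ u) (there i∈) fi gi same rewrite same x (All.lookup x∉ i∈) with g x
... | true  = cong suc (count-punch u i∈ fi gi same)
... | false = count-punch u i∈ fi gi same

splitAt∈ : {x : X} {xs : List X} → x ∈ₗ xs → ∃ λ ys → xs ↭ x ∷ ys
splitAt∈ {x = x} x∈ with ∈-∃++ x∈
... | ys , zs , refl = ys ++ zs , shift x ys zs

Unique-↭ : {xs ys : List X} → xs ↭ ys → Unique xs → Unique ys
Unique-↭ {X = X} p = Permₛ.Unique-resp-↭ (setoid X) (↭⇒↭ₛ p)

Unique-++-disjoint : {xs ys : List X} {x y : X} → Unique (xs ++ ys) → x ∈ₗ xs → y ∈ₗ ys → x ≢ y
Unique-++-disjoint {xs = _ ∷ xs} (x∉ ∷ u) (here refl) y∈ = All.lookup x∉ (∈-++⁺ʳ xs y∈)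
Unique-++-disjoint (_ ∷ u) (there x∈) y∈ = Unique-++-disjoint u x∈ y∈

Unique-++ˡ : (xs : List X) {ys : List X} → Unique (xs ++ ys) → Unique xs
Unique-++ˡ []       _        = []
Unique-++ˡ (x ∷ xs) (x∉ ∷ u) = All.tabulate (λ y∈ → All.lookup x∉ (∈-++⁺ˡ y∈)) ∷ Unique-++ˡ xs u

Unique-++ʳ : (xs : List X) {ys : List X} → Unique (xs ++ ys) → Unique ys
Unique-++ʳ []       u       = u
Unique-++ʳ (x ∷ xs) (_ ∷ u) = Unique-++ʳ xs u

-- Sums and sign products under permutation

sumOver-↭ : (f : X → ℤ) {xs ys : List X} → xs ↭ ys → sumOver f xs ≡ sumOver f ys
sumOver-↭ f Perm.refl         = refl
sumOver-↭ f (Perm.prep x p)   = cong (_+_ (f x)) (sumOver-↭ f p)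
sumOver-↭ f (Perm.swap {xs} {ys} x y p) =
  trans (sym (+-assoc (f x) (f y) (sumOver f xs)))
 (trans (cong₂ _+_ (+-comm (f x) (f y)) (sumOver-↭ f p)) (+-assoc (f y) (f x) (sumOver f ys)))
sumOver-↭ f (Perm.trans p q)  = trans (sumOver-↭ f p) (sumOver-↭ f q)

sumOver-++ : (f : X → ℤ) (xs ys : List X) → sumOver f (xs ++ ys) ≡ sumOver f xs + sumOver f ys
sumOver-++ f []       ys = sym (+-identityˡ _)
sumOver-++ f (x ∷ xs) ys = trans (cong (_+_ (f x)) (sumOver-++ f xs ys))
    (sym (+-assoc (f x) (sumOver f xs) (sumOver f ys)))

sumOver-map : (f : Y → ℤ) (g : X → Y) (xs : List X) → sumOver f (map g xs) ≡ sumOver (f ∘ g) xs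
sumOver-map f g []       = refl
sumOver-map f g (x ∷ xs) = cong (_+_ (f (g x))) (sumOver-map f g xs)

-- `faceSign` over an arbitrary list of coordinates. Invariance under permutation links the order of
-- the cube with the order in which coordinates were labelled.
signProduct : (X → Entry) → (X → Entry) → List X → ℤ
signProduct f g []       = 1ℤ
signProduct f g (x ∷ xs) = entrySign (f x) (g x) * signProduct f g xs

signProduct-↭ : (f g : X → Entry) {xs ys : List X} → xs ↭ ys → signProduct f g xs ≡ signProduct f g ys
signProduct-↭ f g Perm.refl       = refl
signProduct-↭ f g (Perm.prep x p) = cong (entrySign (f x) (g x) *_) (signProduct-↭ f g p)
signProduct-↭ f g (Perm.swap {xs} {ys} x y p) =
  trans (sym (*-assoc s t (signProduct f g xs)))
 (trans (cong₂ _*_ (*-comm s t) (signProduct-↭ f g p)) (*-assoc t s (signProduct f g ys)))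
  where s = entrySign (f x) (g x) ; t = entrySign (f y) (g y)
signProduct-↭ f g (Perm.trans p q) = trans (signProduct-↭ f g p) (signProduct-↭ f g q)

signProduct-++ : (f g : X → Entry) (xs ys : List X) → signProduct f g (xs ++ ys)
    ≡ signProduct f g xs * signProduct f g ys
signProduct-++ f g []       ys = sym (*-identityˡ _)
signProduct-++ f g (x ∷ xs) ys = trans (cong (entrySign (f x) (g x) *_) (signProduct-++ f g xs ys))
  (sym (*-assoc (entrySign (f x) (g x)) (signProduct f g xs) (signProduct f g ys)))

signProduct-star : (f g : X → Entry) (xs : List X) → (∀ x → x ∈ₗ xs → f x ≡ star) → signProduct f g xs ≡ 1ℤ
signProduct-star f g []       h = refl
signProduct-star f g (x ∷ xs) h rewrite h x (here refl) = trans (*-identityˡ _) (signProduct-star f g xs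
    (λ y → h y ∘ there))

signProduct-map : (f g : Y → Entry) (k : X → Y) (xs : List X) → signProduct f g (map k xs) ≡ signProduct
    (f ∘ k) (g ∘ k) xs
signProduct-map f g k []       = refl
signProduct-map f g k (x ∷ xs) = cong (entrySign (f (k x)) (g (k x)) *_) (signProduct-map f g k xs)

signProduct-restriction : (f g : X → Entry) (xs : List X) → (∀ x → f x ≡ star ⊎ f x ≡ g x) → signProduct f g xs ≡ 1ℤ
signProduct-restriction f g []       h = refl
signProduct-restriction f g (x ∷ xs) h with f x | g x | h x
... | star      | _ | _           = trans (*-identityˡ _) (signProduct-restriction f g xs h)
... | fix true  | _ | inj₂ refl = trans (*-identityˡ _) (signProduct-restriction f g xs h)
... | fix false | _ | inj₂ refl = trans (*-identityˡ _) (signProduct-restriction f g xs h)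

-- A star of `g` at a fixed entry of `f` would be a zero factor. This turns a nonzero sign into an
-- inclusion of supports.
signProduct-fixed : {f g : X → Entry} {xs : List X} → signProduct f g xs ≢ 0ℤ →
  ∀ x → x ∈ₗ xs → isFixed (f x) ≡ true → isFixed (g x) ≡ true
signProduct-fixed {f = f} {g} ≢0 x (here refl) fx with f x | g x
... | fix _ | fix _ = refl
... | fix _ | star  = ⊥-elim (≢0 refl)
signProduct-fixed {f = f} {g} {y ∷ ys} ≢0 x (there x∈) fx =
  signProduct-fixed (λ ≡0 → ≢0 (trans (cong (entrySign (f y) (g y) *_) ≡0) (*-zeroʳ (entrySign (f y) (g y))))) x x∈ fx

sign-∷ : ∀ e u d w → sign (e ∷ u) (d ∷ w) ≡ entrySign e d * sign u w
sign-∷ star        u star        w = sym (*-identityˡ _)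
sign-∷ star        u (fix x)     w = sym (*-identityˡ _)
sign-∷ (fix true)  u star        w = refl
sign-∷ (fix false) u star        w = refl
sign-∷ (fix true)  u (fix true)  w = sym (*-identityˡ _)
sign-∷ (fix false) u (fix false) w = sym (*-identityˡ _)
sign-∷ (fix true)  u (fix false) w = sym (-1*i≡-i (sign u w))
sign-∷ (fix false) u (fix true)  w = sym (-1*i≡-i (sign u w))

sign-map : (f g : X → Entry) (xs : List X) → sign (map f xs) (map g xs) ≡ signProduct f g xs
sign-map f g []       = refl
sign-map f g (x ∷ xs) = trans (sign-∷ (f x) (map f xs) (g x) (map g xs)) (cong (entrySign (f x) (g x) *_)
    (sign-map f g xs))

compare-map : ∀ k (f g : X → Entry) (xs : List X) a d →
  compare k (map f xs) (map g xs) a d ≡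
  k (count (λ x → agreeing (f x) (g x)) xs ℕ.+ a) (count (λ x → disagreeing (f x) (g x)) xs ℕ.+ d)
compare-map k f g []       a d = refl
compare-map k f g (x ∷ xs) a d with f x | g x
... | star      | star      = compare-map k f g xs a d
... | star      | fix _     = compare-map k f g xs a d
... | fix true  | star      = compare-map k f g xs a d
... | fix false | star      = compare-map k f g xs a d
... | fix true  | fix true  = trans (compare-map k f g xs (suc a) d)
    (cong (λ i → k i (count (λ y → disagreeing (f y) (g y)) xs ℕ.+ d)) (ℕₚ.+-suc _ a))
... | fix false | fix false = trans (compare-map k f g xs (suc a) d)
    (cong (λ i → k i (count (λ y → disagreeing (f y) (g y)) xs ℕ.+ d)) (ℕₚ.+-suc _ a))
... | fix true  | fix false = trans (compare-map k f g xs a (suc d))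
    (cong (k (count (λ y → agreeing (f y) (g y)) xs ℕ.+ a)) (ℕₚ.+-suc _ d))
... | fix false | fix true  = trans (compare-map k f g xs a (suc d))
    (cong (k (count (λ y → agreeing (f y) (g y)) xs ℕ.+ a)) (ℕₚ.+-suc _ d))

fixedCount-map : (f : X → Entry) (xs : List X) → fixedCount (map f xs) ≡ count (isFixed ∘ f) xs
fixedCount-map f []       = refl
fixedCount-map f (x ∷ xs) with f x
... | star  = fixedCount-map f xs
... | fix _ = cong suc (fixedCount-map f xs)

-- Antipodes

negEntry : Entry → Entry
negEntry star    = star
negEntry (fix b) = fix (not b)

antipode : Face n → Face n
antipode = Vec.map negEntry

-- Reflection of a coordinate when the flag is `false`; agreements, disagreements and signs do not
-- change when both faces are reflected.
orient : Bool → Entry → Entry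
orient true  e = e
orient false e = negEntry e

isFixed-negEntry : ∀ e → isFixed (negEntry e) ≡ isFixed e
isFixed-negEntry star    = refl
isFixed-negEntry (fix _) = refl

negEntry-involutive : ∀ e → negEntry (negEntry e) ≡ e
negEntry-involutive star    = refl
negEntry-involutive (fix b) = cong fix (not-involutive b)

lookup-antipode : (a : Face n) (i : Fin n) → lookup (antipode a) i ≡ negEntry (lookup a i)
lookup-antipode a i = lookup-map i negEntry a

antipode-involutive : (a : Face n) → antipode (antipode a) ≡ a
antipode-involutive []      = refl
antipode-involutive (e ∷ a) = cong₂ _∷_ (negEntry-involutive e) (antipode-involutive a)

isFixed-orient : ∀ s e → isFixed (orient s e) ≡ isFixed e
isFixed-orient true  e = refl
isFixed-orient false e = isFixed-negEntry e

agreeing-orient : ∀ s e d → agreeing (orient s e) (orient s d) ≡ agreeing e d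
agreeing-orient true  e d = refl
agreeing-orient false star        d           = refl
agreeing-orient false (fix true)  star        = refl
agreeing-orient false (fix false) star        = refl
agreeing-orient false (fix true)  (fix true)  = refl
agreeing-orient false (fix true)  (fix false) = refl
agreeing-orient false (fix false) (fix true)  = refl
agreeing-orient false (fix false) (fix false) = refl

disagreeing-orient : ∀ s e d → disagreeing (orient s e) (orient s d) ≡ disagreeing e d
disagreeing-orient true  e d = refl
disagreeing-orient false star        d           = refl
disagreeing-orient false (fix true)  star        = refl
disagreeing-orient false (fix false) star        = refl
disagreeing-orient false (fix true)  (fix true)  = refl
disagreeing-orient false (fix true)  (fix false) = refl
disagreeing-orient false (fix false) (fix true)  = refl
disagreeing-orient false (fix false) (fix false) = refl

entrySign-orient : ∀ s e d → entrySign (orient s e) (orient s d) ≡ entrySign e d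
entrySign-orient true  e d = refl
entrySign-orient false star        d           = refl
entrySign-orient false (fix true)  star        = refl
entrySign-orient false (fix false) star        = refl
entrySign-orient false (fix true)  (fix true)  = refl
entrySign-orient false (fix true)  (fix false) = refl
entrySign-orient false (fix false) (fix true)  = refl
entrySign-orient false (fix false) (fix false) = refl

disagreeing-neg : ∀ e d → disagreeing e (negEntry d) ≡ agreeing e d
disagreeing-neg star        star        = refl
disagreeing-neg star        (fix _)     = refl
disagreeing-neg (fix true)  star        = refl
disagreeing-neg (fix false) star        = refl
disagreeing-neg (fix true)  (fix true)  = refl
disagreeing-neg (fix true)  (fix false) = refl
disagreeing-neg (fix false) (fix true)  = refl
disagreeing-neg (fix false) (fix false) = refl

agreeing-neg : ∀ e d → agreeing e (negEntry d) ≡ disagreeing e d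
agreeing-neg star        star        = refl
agreeing-neg star        (fix _)     = refl
agreeing-neg (fix true)  star        = refl
agreeing-neg (fix false) star        = refl
agreeing-neg (fix true)  (fix true)  = refl
agreeing-neg (fix true)  (fix false) = refl
agreeing-neg (fix false) (fix true)  = refl
agreeing-neg (fix false) (fix false) = refl

-- Multiplication by (-1)^k, kept as iterated negation so that for k = 4 two uses of
-- `neg-involutive` remove it.
negations : ℕ → ℤ → ℤ
negations zero    z = z
negations (suc k) z = - negations k z

negations-0 : ∀ k → negations k 0ℤ ≡ 0ℤ
negations-0 zero    = refl
negations-0 (suc k) = cong -_ (negations-0 k)

negations-neg : ∀ k z → negations k (- z) ≡ - negations k z
negations-neg zero    z = refl
negations-neg (suc k) z = cong -_ (negations-neg k z)

negations-1* : ∀ k z → negations k (1ℤ * z) ≡ negations k z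
negations-1* k z = cong (negations k) (*-identityˡ z)

negations--1* : ∀ k z → - negations k (-[1+ 0 ] * z) ≡ negations k z
negations--1* k z = trans (cong (λ t → - negations k t) (-1*i≡-i z)) (trans (cong -_ (negations-neg k z))
    (neg-involutive _))

signProduct-neg : (f g : X → Entry) (xs : List X) →
  signProduct f (negEntry ∘ g) xs ≡ negations (count (isFixed ∘ f) xs) (signProduct f g xs)
signProduct-neg f g []       = refl
signProduct-neg f g (x ∷ xs) with f x | g x
... | star      | _         = trans (*-identityˡ _) (trans (signProduct-neg f g xs)
    (sym (negations-1* (count (isFixed ∘ f) xs) _)))
... | fix true  | star      = sym (cong -_ (negations-0 (count (isFixed ∘ f) xs)))
... | fix false | star      = sym (cong -_ (negations-0 (count (isFixed ∘ f) xs)))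
... | fix true  | fix true  = trans (-1*i≡-i _) (cong -_ (trans (signProduct-neg f g xs)
    (sym (negations-1* (count (isFixed ∘ f) xs) _))))
... | fix false | fix false = trans (-1*i≡-i _) (cong -_ (trans (signProduct-neg f g xs)
    (sym (negations-1* (count (isFixed ∘ f) xs) _))))
... | fix true  | fix false = trans (*-identityˡ _) (trans (signProduct-neg f g xs)
    (sym (negations--1* (count (isFixed ∘ f) xs) _)))
... | fix false | fix true  = trans (*-identityˡ _) (trans (signProduct-neg f g xs)
    (sym (negations--1* (count (isFixed ∘ f) xs) _)))

Face-ext : {a b : Face n} → (∀ i → lookup a i ≡ lookup b i) → a ≡ b
Face-ext {a = []}    {[]}    h = refl
Face-ext {a = _ ∷ _} {_ ∷ _} h = cong₂ _∷_ (h zero) (Face-ext (h ∘ suc))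

sameSupport⇒Parallel : (a b : Face n) → (∀ i → isFixed (lookup a i) ≡ isFixed (lookup b i)) → Parallel a b
sameSupport⇒Parallel []      []      h = refl
sameSupport⇒Parallel (e ∷ a) (d ∷ b) h = cong₂ _∷_ (star≡ e d (h zero)) (sameSupport⇒Parallel a b (h ∘ suc))
  where
  star≡ : ∀ e d → isFixed e ≡ isFixed d → isStar e ≡ isStar d
  star≡ star    star    _ = refl
  star≡ (fix _) (fix _) _ = refl

fixedIn : Face n → Fin n → Bool
fixedIn a i = isFixed (lookup a i)

fixed+stars : (a : Face n) → count (fixedIn a) (allFin n) ℕ.+ stars a ≡ n
fixed+stars []      = refl
fixed+stars {suc n} (e ∷ a) = byEntry e
  where
  onTail : ∀ e → count (fixedIn (e ∷ a)) (tabulate suc) ≡ count (fixedIn a) (allFin n)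
  onTail e = trans (cong (count (fixedIn (e ∷ a))) (sym (map-tabulate id suc)))
      (count-map (fixedIn (e ∷ a)) suc (allFin n))
  byEntry : ∀ e → count (fixedIn (e ∷ a)) (allFin (suc n)) ℕ.+ stars (e ∷ a) ≡ suc n
  byEntry star    = trans (ℕₚ.+-suc _ _) (cong suc (trans (cong (ℕ._+ stars a) (onTail star)) (fixed+stars a)))
  byEntry (fix b) = cong suc (trans (cong (ℕ._+ stars a) (onTail (fix b))) (fixed+stars a))

faceSign-allFin : (p a : Face n) → faceSign p a ≡ signProduct (lookup p) (lookup a) (allFin n)
faceSign-allFin []      []      = refl
faceSign-allFin {suc n} (e ∷ p) (d ∷ a) = cong (entrySign e d *_) (trans (faceSign-allFin p a)
  (trans (sym (signProduct-map (lookup (e ∷ p)) (lookup (d ∷ a)) suc (allFin n)))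
           (cong (signProduct (lookup (e ∷ p)) (lookup (d ∷ a))) (map-tabulate id suc))))

-- Membership in the lists built by the search

≡⇒T : ∀ {b} → b ≡ true → T b
≡⇒T = Equivalence.from T-≡

T⇒≡ : ∀ {b} → T b → b ≡ true
T⇒≡ = Equivalence.to T-≡

∧-split : ∀ {a b} → a ∧ b ≡ true → a ≡ true × b ≡ true
∧-split {true} {true} _ = refl , refl

∈-filterᵇ⁺ : ∀ {X : Set} {p : X → Bool} {x xs} → x ∈ₗ xs → p x ≡ true → x ∈ₗ filterᵇ p xs
∈-filterᵇ⁺ {p = p} x∈ px = ∈-filter⁺ (T? ∘ p) x∈ (≡⇒T px)

∈-filterᵇ⁻ : ∀ {X : Set} {p : X → Bool} {x xs} → x ∈ₗ filterᵇ p xs → x ∈ₗ xs × p x ≡ true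
∈-filterᵇ⁻ {p = p} {xs = xs} x∈ with ∈-filter⁻ (T? ∘ p) {xs = xs} x∈
... | x∈xs , px = x∈xs , T⇒≡ px

any-false : ∀ {X : Set} {p : X → Bool} {x xs} → any p xs ≡ false → x ∈ₗ xs → p x ≡ false
any-false {p = p} {xs = y ∷ _} none (here refl) with p y
... | false = refl
any-false {p = p} {xs = y ∷ _} none (there x∈) with p y
... | false = any-false none x∈

shortest-∈ : ∀ c cs → shortest c cs ∈ₗ c ∷ cs
shortest-∈ []      cs       = here refl
shortest-∈ (_ ∷ _) []       = here refl
shortest-∈ c@(_ ∷ _) (d ∷ ds) with shorter c d
... | false = there (shortest-∈ d ds)
... | true with shortest-∈ c ds
...   | here eq  = here eq
...   | there c∈ = there (there c∈)

-- The second alternative pays for normalising the global sign: only the first fixed entry may have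
-- to be negated, and it is added while `u` has none. The bound excludes a sixth fixed entry.
∈-extendPattern : ∀ u e → fixedCount (e ∷ u) ℕ.≤ 5 → (e ∷ u) ∈ₗ extendPattern u ⊎ (fixedCount u ≡ 0 ×
    (negEntry e ∷ u) ∈ₗ extendPattern u)
∈-extendPattern u e le with fixedCount u in eq
∈-extendPattern u star        le | zero = inj₁ (here refl)
∈-extendPattern u (fix true)  le | zero = inj₁ (there (here refl))
∈-extendPattern u (fix false) le | zero = inj₂ (refl , there (here refl))
∈-extendPattern u star le | 1 = inj₁ (here refl)
∈-extendPattern u star le | 2 = inj₁ (here refl)
∈-extendPattern u star le | 3 = inj₁ (here refl)
∈-extendPattern u star le | 4 = inj₁ (here refl)
∈-extendPattern u star le | suc (suc (suc (suc (suc _)))) = inj₁ (here refl)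
∈-extendPattern u (fix true) le | 1 = inj₁ (there (here refl))
∈-extendPattern u (fix true) le | 2 = inj₁ (there (here refl))
∈-extendPattern u (fix true) le | 3 = inj₁ (there (here refl))
∈-extendPattern u (fix true) le | 4 = inj₁ (there (here refl))
∈-extendPattern u (fix false) le | 1 = inj₁ (there (there (here refl)))
∈-extendPattern u (fix false) le | 2 = inj₁ (there (there (here refl)))
∈-extendPattern u (fix false) le | 3 = inj₁ (there (there (here refl)))
∈-extendPattern u (fix false) le | 4 = inj₁ (there (there (here refl)))
∈-extendPattern u (fix _) le | suc (suc (suc (suc (suc k)))) = ⊥-elim (ℕₚ.<⇒≱ le (subst (5 ℕ.≤_) (sym eq)
    (ℕₚ.m≤m+n 5 k)))

∈-extend : ∀ {u v C} → u ∈ₗ C → v ∈ₗ extendPattern u → v ∈ₗ extend C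
∈-extend {v = v} {C} u∈ v∈ = ∈-concatMap⁺ extendPattern {xs = C} (Any.map (λ { refl → v∈ }) u∈)

admissible-true : ∀ strict a d → 1 ℕ.≤ a → 1 ℕ.≤ d → a ℕ.+ d ℕ.≤ 4 → (strict ≡ true → ¬ (a ≡ 2 × d ≡ 2)) →
    admissible strict a d ≡ true
admissible-true strict (suc a) (suc d) _ _ le notBalanced rewrite ℕₚ.+-suc a d | T⇒≡
    (ℕₚ.<⇒<ᵇ (ℕₚ.≤-pred le)) with strict
... | false = refl
... | true with a ≡ᵇ 1 in eqa | d ≡ᵇ 1 in eqd
...   | false | _     = refl
...   | true  | false = refl
...   | true  | true  = ⊥-elim (notBalanced refl (cong suc (ℕₚ.≡ᵇ⇒≡ a 1 (≡⇒T eqa)) , cong suc (ℕₚ.≡ᵇ⇒≡ d 1 (≡⇒T eqd))))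

isPositive-true : ∀ z → 0ℤ < z → isPositive z ≡ true
isPositive-true (+ suc _) _ = refl
isPositive-true (+ zero) (+<+ ())

isNegative-true : ∀ z → z < 0ℤ → isNegative z ≡ true
isNegative-true -[1+ _ ] _ = refl
isNegative-true (+ _) (+<+ ())

-- Reading faces through labelled coordinates

-- A labelled coordinate together with the value that is read as `true` there.
Literal : ℕ → Set
Literal n = Fin n × Bool

vertices : ∀ {n} → List (Literal n) → List (Fin n)
vertices = map proj₁

read : ∀ {n} → Face n → Literal n → Entry
read a (i , s) = orient s (lookup a i)

pull : ∀ {n} → List (Literal n) → Face n → Pattern
pull L a = map (read a) L

agreeIn disagreeIn : ∀ {n} → Face n → Face n → Fin n → Bool
agreeIn    a b i = agreeing (lookup a i) (lookup b i)
disagreeIn a b i = disagreeing (lookup a i) (lookup b i)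

agree≤fixed : ∀ {n} (a b : Face n) (xs : List (Fin n)) → count (agreeIn a b) xs ℕ.+ count (disagreeIn a b) xs
    ≡ count (λ i → isFixed (lookup a i) ∧ isFixed (lookup b i)) xs
agree≤fixed a b xs = count-+ xs (λ i → byEntries (lookup a i) (lookup b i))
  where
  byEntries : ∀ e d → (if agreeing e d then suc else id) (if disagreeing e d then 1 else 0) ≡
      (if isFixed e ∧ isFixed d then 1 else 0)
  byEntries star        star        = refl
  byEntries star        (fix _)     = refl
  byEntries (fix true)  star        = refl
  byEntries (fix false) star        = refl
  byEntries (fix true)  (fix true)  = refl
  byEntries (fix true)  (fix false) = refl
  byEntries (fix false) (fix true)  = refl
  byEntries (fix false) (fix false) = refl

compare-pull : ∀ {n} k (L : List (Literal n)) a b → compare k (pull L a) (pull L b) 0 0 ≡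
  k (count (agreeIn a b) (vertices L)) (count (disagreeIn a b) (vertices L))
compare-pull k L a b = trans (compare-map k (read a) (read b) L 0 0) (cong₂ k
  (trans (ℕₚ.+-identityʳ _) (trans (count-cong L (λ { (i , s) _ → agreeing-orient s (lookup a i)
      (lookup b i) })) (sym (count-map (agreeIn a b) proj₁ L))))
  (trans (ℕₚ.+-identityʳ _) (trans (count-cong L (λ { (i , s) _ → disagreeing-orient s (lookup a i)
      (lookup b i) })) (sym (count-map (disagreeIn a b) proj₁ L)))))

fixedCount-pull : ∀ {n} (L : List (Literal n)) a → fixedCount (pull L a) ≡ count (fixedIn a) (vertices L)
fixedCount-pull L a = trans (fixedCount-map (read a) L)
  (trans (count-cong L (λ { (i , s) _ → isFixed-orient s (lookup a i) })) (sym (count-map (fixedIn a) proj₁ L)))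

sign-pull : ∀ {n} (L : List (Literal n)) p a → sign (pull L p) (pull L a) ≡ signProduct (lookup p) (lookup a)
    (vertices L)
sign-pull []            p a = refl
sign-pull ((i , s) ∷ L) p a = trans (sign-∷ (read p (i , s)) (pull L p) (read a (i , s)) (pull L a))
  (cong₂ _*_ (entrySign-orient s (lookup p i) (lookup a i)) (sign-pull L p a))

pull-cong : ∀ {n} (L : List (Literal n)) (a b : Face n) → (∀ j → j ∈ₗ vertices L → lookup a j ≡ lookup b j) →
    pull L a ≡ pull L b
pull-cong []            a b h = refl
pull-cong ((j , t) ∷ L) a b h = cong₂ _∷_ (cong (orient t) (h j (here refl))) (pull-cong L a b (λ k → h k ∘ there))

-- Every pattern formed by `drops` comes from an actual face with one fixed coordinate freed, so the
-- Fourier identity applies to it. Labels are distinct, hence freeing `i` changes a single entry of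
-- the pattern.
drops-pull : ∀ {n} (L : List (Literal n)) (a : Face n) → Unique (vertices L) → ∀ {p} → p ∈ₗ drops (pull L a) →
  ∃ λ i → i ∈ₗ vertices L × fixedIn a i ≡ true × p ≡ pull L (a [ i ]≔ star)
drops-pull ((i , s) ∷ L) a (i∉ ∷ uniq) {p} p∈ with orient s (lookup a i) in eq
drops-pull ((i , s) ∷ L) a (i∉ ∷ uniq) p∈ | star with ∈-map⁻ (star ∷_) p∈
... | q , q∈ , refl with drops-pull L a uniq q∈
...   | j , j∈ , fixed , refl = j , there j∈ , fixed ,
  cong (_∷ _) (sym (trans (cong (orient s) (lookup∘update′ (All.lookup i∉ j∈) a star)) eq))
drops-pull ((i , s) ∷ L) a (i∉ ∷ uniq) (here refl) | fix b =
  i , here refl , trans (sym (isFixed-orient s (lookup a i))) (cong isFixed eq) , cong₂ _∷_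
      (sym (trans (cong (orient s) (lookup∘update i a star)) (orient-star s)))
    (pull-cong L a (a [ i ]≔ star) (λ j j∈ → sym (lookup∘update′ (All.lookup i∉ j∈ ∘ sym) a star)))
  where
  orient-star : ∀ s → orient s star ≡ star
  orient-star true  = refl
  orient-star false = refl
drops-pull ((i , s) ∷ L) a (i∉ ∷ uniq) (there p∈) | fix b with ∈-map⁻ (fix b ∷_) p∈
... | q , q∈ , refl with drops-pull L a uniq q∈
...   | j , j∈ , fixed , refl = j , there j∈ , fixed ,
  cong (_∷ _) (sym (trans (cong (orient s) (lookup∘update′ (All.lookup i∉ j∈) a star)) eq))

Covered : ∀ {n} → List (Literal n) → Clause → Face n → Set
Covered L C c = pull L c ∈ₗ C ⊎ pull L (antipode c) ∈ₗ C

-- Before the first fixed entry a face and its antipode look alike; this lets `extendPattern`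
-- postpone the choice of the global sign.
pull-antipode-0 : ∀ {n} (L : List (Literal n)) c → fixedCount (pull L c) ≡ 0 → pull L (antipode c) ≡ pull L c
pull-antipode-0 []            c _ = refl
pull-antipode-0 ((i , s) ∷ L) c none rewrite lookup-antipode c i with lookup c i
pull-antipode-0 ((i , true)  ∷ L) c none | star = cong (star ∷_) (pull-antipode-0 L c none)
pull-antipode-0 ((i , false) ∷ L) c none | star = cong (star ∷_) (pull-antipode-0 L c none)
pull-antipode-0 ((i , true)  ∷ L) c ()   | fix _
pull-antipode-0 ((i , false) ∷ L) c ()   | fix _

Covered-extend : ∀ {n} {L : List (Literal n)} {C} l c → count (fixedIn c) (vertices (l ∷ L)) ℕ.≤ 5 →
    Covered L C c → Covered (l ∷ L) (extend C) c
Covered-extend {L = L} {C} l@(i , s) c le cov = either cov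
  where
  swapSides : ∀ c → Covered (l ∷ L) (extend C) (antipode c) → Covered (l ∷ L) (extend C) c
  swapSides c (inj₁ c∈) = inj₂ c∈
  swapSides c (inj₂ c∈) = inj₁ (subst (λ d → pull (l ∷ L) d ∈ₗ extend C) (antipode-involutive c) c∈)
  read-antipode : ∀ c s → negEntry (orient s (lookup c i)) ≡ orient s (lookup (antipode c) i)
  read-antipode c true  = sym (lookup-antipode c i)
  read-antipode c false = cong negEntry (sym (lookup-antipode c i))
  direct : ∀ c → count (fixedIn c) (vertices (l ∷ L)) ℕ.≤ 5 → pull L c ∈ₗ C → Covered (l ∷ L) (extend C) c
  direct c le c∈ with ∈-extendPattern (pull L c) (read c l) (subst (ℕ._≤ 5) (sym (fixedCount-pull (l ∷ L) c)) le)
  ... | inj₁ found = inj₁ (∈-extend c∈ found)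
  ... | inj₂ (none , found) = inj₂ (∈-extend c∈ (subst (_∈ₗ extendPattern (pull L c))
          (cong₂ _∷_ (read-antipode c s) (sym (pull-antipode-0 L c none))) found))
  either : Covered L C c → Covered (l ∷ L) (extend C) c
  either (inj₁ c∈) = direct c le c∈
  -- The antipode has the same fixed coordinates, so the direct case applies to it and the two sides
  -- are exchanged afterwards.
  either (inj₂ c∈) = swapSides c (direct (antipode c) (subst (ℕ._≤ 5) (count-cong (vertices (l ∷ L))
    (λ j _ → sym (trans (cong isFixed (lookup-antipode c j)) (isFixed-negEntry (lookup c j))))) le) c∈)

signProduct-cong : {X : Set} (f : X → Entry) {g h : X → Entry} (xs : List X) → (∀ x → g x ≡ h x) →
    signProduct f g xs ≡ signProduct f h xs
signProduct-cong f []       eq = refl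
signProduct-cong f (x ∷ xs) eq = cong₂ (λ e z → entrySign (f x) e * z) (eq x) (signProduct-cong f xs eq)

remainderNegative : ∀ s r → s + r ≡ 0ℤ → 0ℤ < s → r < 0ℤ
remainderNegative s r eq 0<s with r <? 0ℤ
... | yes r<0 = r<0
... | no  r≮0 = ⊥-elim (<-irrefl (sym eq) (+-mono-<-≤ 0<s (≮⇒≥ r≮0)))

remainderPositive : ∀ s r → s + r ≡ 0ℤ → s < 0ℤ → 0ℤ < r
remainderPositive s r eq s<0 with 0ℤ <? r
... | yes 0<r = 0<r
... | no  0≮r = ⊥-elim (<-irrefl eq (+-mono-<-≤ s<0 (≮⇒≥ 0≮r)))

star-unfixed : ∀ {e} → isFixed e ≡ false → e ≡ star
star-unfixed {star} _ = refl

agreeing-star : ∀ e → agreeing e star ≡ false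
agreeing-star star        = refl
agreeing-star (fix true)  = refl
agreeing-star (fix false) = refl

disagreeing-star : ∀ e → disagreeing e star ≡ false
disagreeing-star star        = refl
disagreeing-star (fix true)  = refl
disagreeing-star (fix false) = refl

fixedIn-punch : ∀ {n} (a : Face n) i → fixedIn a i ≡ true → count (fixedIn a) (allFin n) ≡ suc
    (count (fixedIn (a [ i ]≔ star)) (allFin n))
fixedIn-punch {n} a i fixed = count-punch (allFin⁺ n) (∈-allFin i) fixed (cong isFixed (lookup∘update i a star))
  (λ j j≢i → cong isFixed (sym (lookup∘update′ j≢i a star)))

-- Pairs of faces of an antipodal 5-splitting

module Faces {n : ℕ} (n≥5 : n ≥ 5) {A : List (Face n)} (S : AntipodalSplitting n 5 A) where
  open AntipodalSplitting S
  open Partition n≥5 S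

  fixedTotal : ∀ {a} → a ∈ₗ A → count (fixedIn a) (allFin n) ≡ 5
  fixedTotal {a} a∈ = ℕₚ.+-cancelʳ-≡ (n ∸ 5) _ 5
    (trans (cong (count (fixedIn a) (allFin n) ℕ.+_) (sym (dim a a∈))) (trans (fixed+stars a) (sym (ℕₚ.m+[n∸m]≡n n≥5))))

  abstract
    hasFixed : ∀ {a} → a ∈ₗ A → ∃ λ i → fixedIn a i ≡ true
    hasFixed {a} a∈ = proj₁ found , proj₂ (proj₂ found)
      where
      found : ∃ λ i → i ∈ₗ allFin n × fixedIn a i ≡ true
      found = count-positive (allFin n) (subst (0 ℕ.<_) (sym (fixedTotal a∈)) (ℕ.s≤s ℕ.z≤n))

  -- Both supports have five elements, so inclusion gives equality and the faces are parallel, hence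
  -- antipodal by the splitting. `Antipodal` determines the fixed entries; the stars come from the
  -- equality of supports.
  sameSupport⇒antipode : ∀ {a b} → a ∈ₗ A → b ∈ₗ A → a ≢ b → (∀ i → fixedIn a i ≡ true → fixedIn b i ≡ true) →
      b ≡ antipode a
  sameSupport⇒antipode {a} {b} a∈ b∈ a≢b a⊆b = Face-ext (λ i → trans (entry (lookup a i) (lookup b i)
      (supports i) (proj₂ anti i)) (sym (lookup-antipode a i)))
    where
    supports : ∀ i → fixedIn a i ≡ fixedIn b i
    supports i with fixedIn a i in eqa | fixedIn b i in eqb
    ... | true  | true  = refl
    ... | false | false = refl
    ... | true  | false = trans (sym (a⊆b i eqa)) eqb
    ... | false | true  = trans (sym eqa) (count-saturated (allFin n) a⊆b
        (ℕₚ.≤-reflexive (trans (fixedTotal b∈) (sym (fixedTotal a∈)))) i (∈-allFin i) eqb)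
    anti : Antipodal a b
    anti = antipodal a b a∈ b∈ a≢b (sameSupport⇒Parallel a b supports)
    entry : ∀ e d → isFixed e ≡ isFixed d → (∀ c → e ≡ fix c → d ≡ fix (not c)) → d ≡ negEntry e
    entry star    star _ _ = refl
    entry (fix c) d    _ h = h c refl

  faceSign-restriction : ∀ p a → (∀ i → lookup p i ≡ star ⊎ lookup p i ≡ lookup a i) → 0ℤ < faceSign p a
  faceSign-restriction p a h = subst (0ℤ <_) (sym (trans (faceSign-allFin p a) (signProduct-restriction
      (lookup p) (lookup a) (allFin n) h))) (+<+ (ℕ.s≤s ℕ.z≤n))

  faceSign-self : ∀ a → 0ℤ < faceSign a a
  faceSign-self a = faceSign-restriction a a (λ _ → inj₂ refl)

  abstract
    -- Taking the positive term of `a` out of a zero sum leaves a negative sum.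
    oppositeSign : ∀ {a} p i → fixedIn p i ≡ true → a ∈ₗ A → 0ℤ < faceSign p a → ∃ λ c → c ∈ₗ A × faceSign p c < 0ℤ
    oppositeSign {a} p i fixed a∈ 0<sign = proj₁ found , ∈-resp-↭ (↭-sym (proj₂ rest))
        (there (proj₁ (proj₂ found))) , proj₂ (proj₂ found)
      where
      rest : ∃ λ ys → A ↭ a ∷ ys
      rest = splitAt∈ a∈
      found : ∃ λ c → c ∈ₗ proj₁ rest × faceSign p c < 0ℤ
      found = negativeTerm {f = faceSign p} (proj₁ rest)
        (remainderNegative (faceSign p a) _ (trans (sym (sumOver-↭ (faceSign p) (proj₂ rest)))
            (faceSign-sum p i fixed)) 0<sign)

    -- With `a` itself as reference, a face of negative sign differs from `a`, and its sign being
    -- nonzero it fixes every coordinate of `β a`.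
    antipode∈ : ∀ {a} → a ∈ₗ A → antipode a ∈ₗ A
    antipode∈ {a} a∈ = subst (_∈ₗ A) (sameSupport⇒antipode a∈ c∈ a≢c a⊆c) c∈
      where
      opposite : ∃ λ c → c ∈ₗ A × faceSign a c < 0ℤ
      opposite = oppositeSign a (proj₁ (hasFixed a∈)) (proj₂ (hasFixed a∈)) a∈ (faceSign-self a)
      c : Face n
      c = proj₁ opposite
      c∈ : c ∈ₗ A
      c∈ = proj₁ (proj₂ opposite)
      neg<0 : faceSign a c < 0ℤ
      neg<0 = proj₂ (proj₂ opposite)
      a≢c : a ≢ c
      a≢c a≡c = <-asym neg<0 (subst (λ d → 0ℤ < faceSign a d) a≡c (faceSign-self a))
      a⊆c : ∀ i → fixedIn a i ≡ true → fixedIn c i ≡ true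
      a⊆c i = signProduct-fixed (λ ≡0 → <-irrefl (trans (faceSign-allFin a c) ≡0) neg<0) i (∈-allFin i)

  antipode≢ : ∀ {a} → a ∈ₗ A → antipode a ≢ a
  antipode≢ {a} a∈ eq with hasFixed a∈
  ... | i , fixed = noFixedPoint (lookup a i) fixed (trans (sym (lookup-antipode a i)) (cong (λ b → lookup b i) eq))
    where
    noFixedPoint : ∀ e → isFixed e ≡ true → negEntry e ≢ e
    noFixedPoint (fix true)  _ ()
    noFixedPoint (fix false) _ ()

  some-disagreement : ∀ {a b} → a ∈ₗ A → b ∈ₗ A → a ≢ b → 1 ℕ.≤ count (disagreeIn a b) (allFin n)
  some-disagreement a∈ b∈ a≢b with disjoint a∈ b∈ a≢b
  ... | i , dis = positive-count (∈-allFin i) dis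

  some-agreement : ∀ {a b} → a ∈ₗ A → b ∈ₗ A → a ≢ antipode b → 1 ℕ.≤ count (agreeIn a b) (allFin n)
  some-agreement {a} {b} a∈ b∈ a≢b̄ with disjoint a∈ (antipode∈ b∈) a≢b̄
  ... | i , dis = positive-count (∈-allFin i) (trans (sym (disagreeing-neg (lookup a i) (lookup b i)))
                    (trans (cong (disagreeing (lookup a i)) (sym (lookup-antipode b i))) dis))

  ∧-trueˡ : ∀ {x y} → x ∧ y ≡ true → x ≡ true
  ∧-trueˡ = proj₁ ∘ ∧-split

  -- Five common fixed coordinates would make the supports equal, and `b` would be the antipode of
  -- `a`.
  overlap≤4 : ∀ {a b} → a ∈ₗ A → b ∈ₗ A → a ≢ b → a ≢ antipode b →
    count (agreeIn a b) (allFin n) ℕ.+ count (disagreeIn a b) (allFin n) ℕ.≤ 4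
  overlap≤4 {a} {b} a∈ b∈ a≢b a≢b̄ rewrite agree≤fixed a b (allFin n) with count
      (λ i → fixedIn a i ∧ fixedIn b i) (allFin n) ℕ.≤? 4
  ... | yes ≤4 = ≤4
  ... | no  ≰4 = ⊥-elim (a≢b̄ (trans (sym (antipode-involutive a))
      (cong antipode (sym (sameSupport⇒antipode a∈ b∈ a≢b a⊆b)))))
    where
    a⊆b : ∀ i → fixedIn a i ≡ true → fixedIn b i ≡ true
    a⊆b i fixed = proj₂ (∧-split {fixedIn a i} (count-saturated (allFin n) (λ j → ∧-trueˡ)
      (ℕₚ.≤-trans (ℕₚ.≤-reflexive (fixedTotal a∈)) (ℕₚ.≰⇒> ≰4)) i (∈-allFin i) fixed))

  faceSign-antipode : ∀ p a → count (fixedIn p) (allFin n) ≡ 4 → faceSign p (antipode a) ≡ faceSign p a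
  faceSign-antipode p a four = begin
    faceSign p (antipode a)                                            ≡⟨ faceSign-allFin p (antipode a) ⟩
    signProduct (lookup p) (lookup (antipode a)) (allFin n)            ≡⟨ signProduct-cong (lookup p)
        (allFin n) (lookup-antipode a) ⟩
    signProduct (lookup p) (negEntry ∘ lookup a) (allFin n)            ≡⟨ signProduct-neg (lookup p)
        (lookup a) (allFin n) ⟩
    negations (count (fixedIn p) (allFin n)) (signProduct (lookup p) (lookup a) (allFin n))
        ≡⟨ cong₂ negations four (sym (faceSign-allFin p a)) ⟩
    negations 4 (faceSign p a)                                         ≡⟨ neg-involutive _ ⟩
    negations 2 (faceSign p a)                                         ≡⟨ neg-involutive _ ⟩
    faceSign p a                                                       ∎
    where open ≡-Reasoning

-- Soundness of the search

-- `unbalanced` is conditioned on `strict` so that one soundness proof serves both searches.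
module Soundness {n : ℕ} (n≥5 : n ≥ 5) {A : List (Face n)} (S : AntipodalSplitting n 5 A)
  (strict : Bool) (unbalanced : strict ≡ true → ∀ {a b} → a ∈ₗ A → b ∈ₗ A →
     ¬ (count (agreeIn a b) (allFin n) ≡ 2 × count (disagreeIn a b) (allFin n) ≡ 2)) where
  open AntipodalSplitting S
  open Partition n≥5 S
  open Faces n≥5 S

  Coordinates : List (Literal n) → List (Fin n) → Set
  Coordinates L M = vertices L ++ M ↭ allFin n

  Within : List (Fin n) → Face n → Set
  Within M b = ∀ i → i ∈ₗ M → lookup b i ≡ star

  -- K holds the chosen faces, one from each antipodal pair, and R all remaining ones.
  record Selected (K R : List (Face n)) : Set where
    constructor selected
    field permutation : K ++ (map antipode K ++ R) ↭ A
  open Selected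

  -- Chosen faces are known exactly, the others only from above: pool and clauses may list patterns
  -- that belong to no face, as long as every remaining face is in the pool and every clause lists
  -- some remaining face, up to antipodes.
  record Represents (L : List (Literal n)) (M : List (Fin n)) (K R : List (Face n)) (s : State) : Set where
    open State s
    field
      coordinates : Coordinates L M
      faces       : Selected K R
      within      : ∀ {b} → b ∈ₗ K → Within M b
      blocks≡     : blocks ≡ map (pull L) K
      pool✓       : ∀ {c} → c ∈ₗ R → Covered L pool c
      clauses✓    : ∀ {C} → C ∈ₗ clauses → ∃ λ c → c ∈ₗ R × Covered L C c

  count-coordinates : ∀ L M → Coordinates L M → (f : Fin n → Bool) → count f (vertices L) ℕ.+ count f M
      ≡ count f (allFin n)
  count-coordinates L M coords f = trans (sym (count-++ f (vertices L) M)) (count-↭ f coords)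

  count-within : ∀ L M → Coordinates L M → (f : Fin n → Bool) → (∀ i → i ∈ₗ M → f i ≡ false) → count f
      (vertices L) ≡ count f (allFin n)
  count-within L M coords f none = trans (sym (ℕₚ.+-identityʳ _))
    (trans (cong (count f (vertices L) ℕ.+_) (sym (count-none M none))) (count-coordinates L M coords f))

  faceSign-pull : ∀ L M → Coordinates L M → ∀ p a → Within M p → sign (pull L p) (pull L a) ≡ faceSign p a
  faceSign-pull L M coords p a p⊆ = begin
    sign (pull L p) (pull L a)                                            ≡⟨ sign-pull L p a ⟩
    signProduct (lookup p) (lookup a) (vertices L)                        ≡⟨ sym (*-identityʳ _) ⟩
    signProduct (lookup p) (lookup a) (vertices L) * 1ℤ                   ≡⟨ cong (signProduct (lookup p)
        (lookup a) (vertices L) *_) (sym (signProduct-star (lookup p) (lookup a) M p⊆)) ⟩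
    signProduct (lookup p) (lookup a) (vertices L) * signProduct (lookup p) (lookup a) M ≡⟨ sym
        (signProduct-++ (lookup p) (lookup a) (vertices L) M) ⟩
    signProduct (lookup p) (lookup a) (vertices L ++ M)                   ≡⟨ signProduct-↭ (lookup p)
        (lookup a) coords ⟩
    signProduct (lookup p) (lookup a) (allFin n)                          ≡⟨ sym (faceSign-allFin p a) ⟩
    faceSign p a                                                          ∎
    where open ≡-Reasoning


  -- All fixed coordinates of `b` are labelled, so the labels show every agreement and disagreement,
  -- however little of `a` is known.
  compatible-pull : ∀ L M → Coordinates L M → ∀ {a b} → a ∈ₗ A → b ∈ₗ A → a ≢ b → a ≢ antipode b → Within M b →
    compatible strict (pull L a) (pull L b) ≡ true
  compatible-pull L M coords {a} {b} a∈ b∈ a≢b a≢b̄ b⊆ = trans (compare-pull (admissible strict) L a b)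
    (trans (cong₂ (admissible strict)
        (count-within L M coords (agreeIn a b) (λ i i∈ → trans (cong (agreeing (lookup a i)) (b⊆ i i∈))
            (agreeing-star (lookup a i))))
        (count-within L M coords (disagreeIn a b) (λ i i∈ → trans (cong (disagreeing (lookup a i)) (b⊆ i i∈))
            (disagreeing-star (lookup a i)))))
      (admissible-true strict _ _ (some-agreement a∈ b∈ a≢b̄) (some-disagreement a∈ b∈ a≢b) (overlap≤4 a∈ b∈ a≢b a≢b̄)
        (λ s → unbalanced s a∈ b∈)))

  sameSupport-pull : ∀ L M → Coordinates L M → ∀ {a b} → b ∈ₗ A → (∀ i → fixedIn b i ≡ true → fixedIn a i
      ≡ true) → Within M b →
    sameSupport (pull L a) (pull L b) ≡ true
  sameSupport-pull L M coords {a} {b} b∈ b⊆a b⊆ = trans (compare-pull (λ x y → 4 <ᵇ x ℕ.+ y) L a b)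
    (trans (cong (4 <ᵇ_) (trans (agree≤fixed a b (vertices L)) (trans (count-cong (vertices L) (λ i _ → both i))
      (trans (count-within L M coords (fixedIn b) (λ i i∈ → cong isFixed (b⊆ i i∈))) (fixedTotal b∈))))) refl)
    where
    both : ∀ i → fixedIn a i ∧ fixedIn b i ≡ fixedIn b i
    both i with fixedIn b i in eq
    ... | true rewrite b⊆a i eq = refl
    ... | false with fixedIn a i
    ...   | true  = refl
    ...   | false = refl

  module Remainder {K R : List (Face n)} (faces : Selected K R) where
    uniq : Unique (K ++ (map antipode K ++ R))
    uniq = Unique-↭ (↭-sym (permutation faces)) distinct

    R⊆A : ∀ {c} → c ∈ₗ R → c ∈ₗ A
    R⊆A c∈ = ∈-resp-↭ (permutation faces) (∈-++⁺ʳ K (∈-++⁺ʳ (map antipode K) c∈))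

    R≢K : ∀ {c b} → c ∈ₗ R → b ∈ₗ K → c ≢ b
    R≢K c∈ b∈ eq = Unique-++-disjoint uniq b∈ (∈-++⁺ʳ (map antipode K) c∈) (sym eq)

    R≢K̄ : ∀ {c b} → c ∈ₗ R → b ∈ₗ K → c ≢ antipode b
    R≢K̄ c∈ b∈ eq = Unique-++-disjoint (Unique-++ʳ K uniq) (∈-map⁺ antipode b∈) c∈ (sym eq)

    -- `A` is closed under antipodes. If the antipode of `c` were in `K` or in `map antipode K`,
    -- then `c` would be in the other of the two, against uniqueness of the enumeration.
    R-antipode : ∀ {c} → c ∈ₗ R → antipode c ∈ₗ R
    R-antipode {c} c∈ with ∈-++⁻ K (∈-resp-↭ (↭-sym (permutation faces)) (antipode∈ (R⊆A c∈)))
    ... | inj₁ c̄∈K = ⊥-elim (R≢K̄ c∈ c̄∈K (sym (antipode-involutive c)))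
    ... | inj₂ c̄∈ with ∈-++⁻ (map antipode K) c̄∈
    ...   | inj₂ c̄∈R = c̄∈R
    ...   | inj₁ c̄∈K̄ with ∈-map⁻ antipode c̄∈K̄
    ...     | b , b∈ , eq = ⊥-elim (R≢K c∈ b∈ (trans (sym (antipode-involutive c)) (trans (cong antipode eq)
        (antipode-involutive b))))

    oriented : ∀ {L : List (Literal n)} {C c} → c ∈ₗ R → Covered L C c → ∃ λ d → d ∈ₗ R ×
        (d ≡ c ⊎ d ≡ antipode c) × pull L d ∈ₗ C
    oriented {c = c} c∈ (inj₁ d∈) = c , c∈ , inj₁ refl , d∈
    oriented {c = c} c∈ (inj₂ d∈) = antipode c , R-antipode c∈ , inj₂ refl , d∈

    covered : ∀ {L : List (Literal n)} {C c d} → (d ≡ c ⊎ d ≡ antipode c) → pull L d ∈ₗ C → Covered L C c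
    covered (inj₁ refl) d∈ = inj₁ d∈
    covered (inj₂ refl) d∈ = inj₂ d∈

  removePair : ∀ {K R c} → Selected K R → c ∈ₗ R →
    ∃ λ R′ → Selected (c ∷ K) R′ × (∀ {d} → d ∈ₗ R′ → d ∈ₗ R) × (∀ {d} → d ∈ₗ R → d ≢ c → d ≢ antipode c → d ∈ₗ R′)
  removePair {K} {R} {c} faces c∈ with splitAt∈ c∈
  ... | R₁ , R↭ with ∈-resp-↭ R↭ (Remainder.R-antipode faces c∈)
  ...   | here eq = ⊥-elim (antipode≢ (Remainder.R⊆A faces c∈) eq)
  ...   | there c̄∈ with splitAt∈ c̄∈
  ...     | R₂ , R₁↭ = R₂ , selected (↭-trans regroup (permutation faces)) , (λ d∈ → ∈-resp-↭ (↭-sym R↭′)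
      (there (there d∈))) , remains
    where
    R↭′ : R ↭ c ∷ antipode c ∷ R₂
    R↭′ = ↭-trans R↭ (Perm.prep c R₁↭)
    K̄ = map antipode K
    regroup : c ∷ (K ++ (antipode c ∷ (K̄ ++ R₂))) ↭ K ++ (K̄ ++ R)
    regroup = ↭-trans (↭-sym (shift c K (antipode c ∷ (K̄ ++ R₂))))
              (++⁺ˡ K (↭-trans (Perm.prep c (↭-sym (shift (antipode c) K̄ R₂)))
                (↭-trans (↭-sym (shift c K̄ (antipode c ∷ R₂))) (++⁺ˡ K̄ (↭-sym R↭′)))))
    remains : ∀ {d} → d ∈ₗ R → d ≢ c → d ≢ antipode c → d ∈ₗ R₂
    remains d∈ d≢c d≢c̄ with ∈-resp-↭ R↭′ d∈
    ... | here eq           = ⊥-elim (d≢c eq)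
    ... | there (here eq)   = ⊥-elim (d≢c̄ eq)
    ... | there (there d∈′) = d∈′

  signSum-pull : ∀ L M → Coordinates L M → ∀ p → Within M p → ∀ K → signSum (pull L p) (map (pull L) K)
      ≡ sumOver (faceSign p) K
  signSum-pull L M coords p p⊆ []      = refl
  signSum-pull L M coords p p⊆ (b ∷ K) = cong₂ _+_ (faceSign-pull L M coords p b p⊆) (signSum-pull L M coords p p⊆ K)

  -- The second copy of the sum over `K` stands for the antipodes, whose signs on four coordinates
  -- are the same.
  balance : ∀ {K R} → Selected K R → ∀ p → count (fixedIn p) (allFin n) ≡ 4 →
    (sumOver (faceSign p) K + sumOver (faceSign p) K) + sumOver (faceSign p) R ≡ 0ℤ
  balance {K} {R} faces p four = begin
    (ΣK + ΣK) + ΣR                                                    ≡⟨ +-assoc ΣK ΣK ΣR ⟩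
    ΣK + (ΣK + ΣR)                                                    ≡⟨ cong (λ z → ΣK + (z + ΣR)) (sym antipodes) ⟩
    ΣK + (sumOver (faceSign p) (map antipode K) + ΣR)                 ≡⟨ cong (_+_ ΣK)
        (sym (sumOver-++ (faceSign p) (map antipode K) R)) ⟩
    ΣK + sumOver (faceSign p) (map antipode K ++ R)                   ≡⟨ sym (sumOver-++ (faceSign p) K
        (map antipode K ++ R)) ⟩
    sumOver (faceSign p) (K ++ (map antipode K ++ R))                 ≡⟨ sumOver-↭ (faceSign p) (permutation faces) ⟩
    sumOver (faceSign p) A                                            ≡⟨ faceSign-sum p (proj₁ someFixed)
        (proj₂ (proj₂ someFixed)) ⟩
    0ℤ                                                                ∎
    where
    open ≡-Reasoning
    ΣK ΣR : ℤ
    ΣK = sumOver (faceSign p) K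
    ΣR = sumOver (faceSign p) R
    antipodes : sumOver (faceSign p) (map antipode K) ≡ ΣK
    antipodes = trans (sumOver-map (faceSign p) antipode K) (sumOver-cong K (λ a _ → faceSign-antipode p a four))
    someFixed : ∃ λ i → i ∈ₗ allFin n × fixedIn p i ≡ true
    someFixed = count-positive (allFin n) (subst (0 ℕ.<_) (sym four) (ℕ.s≤s ℕ.z≤n))

  -- The pool may hold the pattern of the antipode instead of `c`; on four coordinates the sign is
  -- the same, so the test does not depend on which one is stored.
  filtered : ∀ L M → Coordinates L M → ∀ {K R} → Selected K R → ∀ {pool} →
    (∀ {c} → c ∈ₗ R → Covered L pool c) → ∀ p → Within M p → count (fixedIn p) (allFin n) ≡ 4 →
    (test : ℤ → Bool) → ∀ {c} → c ∈ₗ R → test (faceSign p c) ≡ true →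
    Covered L (filterᵇ (λ x → test (sign (pull L p) x)) pool) c
  filtered L M coords faces pool✓ p p⊆ four test {c} c∈ passes with Remainder.oriented faces c∈ (pool✓ c∈)
  ... | d , d∈ , d≡±c , d∈pool = Remainder.covered faces d≡±c (∈-filterᵇ⁺ d∈pool
      (trans (cong test (trans (faceSign-pull L M coords p d p⊆) (same d≡±c))) passes))
    where
    same : d ≡ c ⊎ d ≡ antipode c → faceSign p d ≡ faceSign p c
    same (inj₁ eq) = cong (faceSign p) eq
    same (inj₂ eq) = trans (cong (faceSign p) eq) (faceSign-antipode p c four)

  clauseFor-sound : ∀ L M → Coordinates L M → ∀ {K R} → Selected K R → ∀ {pool} →
    (∀ {c} → c ∈ₗ R → Covered L pool c) → ∀ p → Within M p → count (fixedIn p) (allFin n) ≡ 4 →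
    ∀ {C} → C ∈ₗ clauseFor (map (pull L) K) pool (pull L p) → ∃ λ c → c ∈ₗ R × Covered L C c
  -- A zero sum produces no clause, so only the two nonzero cases arise.
  clauseFor-sound L M coords {K} {R} faces pool✓ p p⊆ four C∈
    with signSum (pull L p) (map (pull L) K) | signSum-pull L M coords p p⊆ K
  clauseFor-sound L M coords {K} {R} faces pool✓ p p⊆ four (here refl) | + suc k | total = c , c∈ ,
      filtered L M coords faces pool✓ p p⊆ four isNegative c∈ (isNegative-true _ sign<0)
    where
    found : ∃ λ c → c ∈ₗ R × faceSign p c < 0ℤ
    found = negativeTerm R (remainderNegative _ _ (balance faces p four) (subst (λ s → 0ℤ < s + s) total
        (+<+ (ℕ.s≤s ℕ.z≤n))))
    c = proj₁ found
    c∈ = proj₁ (proj₂ found)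
    sign<0 = proj₂ (proj₂ found)
  clauseFor-sound L M coords {K} {R} faces pool✓ p p⊆ four (here refl) | -[1+ k ] | total = c , c∈ ,
      filtered L M coords faces pool✓ p p⊆ four isPositive c∈ (isPositive-true _ 0<sign)
    where
    found : ∃ λ c → c ∈ₗ R × 0ℤ < faceSign p c
    found = positiveTerm R (remainderPositive _ _ (balance faces p four) (subst (λ s → s + s < 0ℤ) total -<+))
    c = proj₁ found
    c∈ = proj₁ (proj₂ found)
    0<sign = proj₂ (proj₂ found)

  fixed≤5 : ∀ L M → Coordinates L M → ∀ {c} → c ∈ₗ A → count (fixedIn c) (vertices L) ℕ.≤ 5
  fixed≤5 L M coords {c} c∈ = subst (count (fixedIn c) (vertices L) ℕ.≤_) (trans (count-coordinates L M coords
      (fixedIn c)) (fixedTotal c∈)) (ℕₚ.m≤m+n _ _)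

  addCoordinate-sound : ∀ {L M K R s} → Represents L M K R s → ∀ {i} → i ∈ₗ M → ∀ t →
    ∃ λ M′ → Represents ((i , t) ∷ L) M′ K R (addCoordinate s)
  addCoordinate-sound {L} {M} {K} {R} {s} rep {i} i∈ t = M′ , record
    { coordinates = coords′
    ; faces       = faces
    ; within      = λ b∈ j j∈ → within b∈ j (∈-resp-↭ (↭-sym M↭) (there j∈))
    ; blocks≡     = trans (cong (map (star ∷_)) blocks≡) (starred K within)
    ; pool✓       = λ {c} c∈ → Covered-extend (i , t) c (fixed≤5 ((i , t) ∷ L) M′ coords′ (R⊆A c∈)) (pool✓ c∈)
    ; clauses✓    = clauses✓′
    }
    where
    open Represents rep
    open Remainder faces
    M′ : List (Fin n)
    M′ = proj₁ (splitAt∈ i∈)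
    M↭ : M ↭ i ∷ M′
    M↭ = proj₂ (splitAt∈ i∈)
    coords′ : Coordinates ((i , t) ∷ L) M′
    coords′ = ↭-trans (↭-sym (shift i (vertices L) M′)) (↭-trans (++⁺ˡ (vertices L) (↭-sym M↭)) coordinates)
    orient-star : ∀ t → star ≡ orient t star
    orient-star true  = refl
    orient-star false = refl
    starred : ∀ K → (∀ {b} → b ∈ₗ K → Within M b) → map (star ∷_) (map (pull L) K) ≡ map (pull ((i , t) ∷ L)) K
    starred []      w = refl
    starred (b ∷ K) w = cong₂ _∷_ (cong (_∷ pull L b) (trans (orient-star t)
        (cong (orient t) (sym (w (here refl) i i∈))))) (starred K (w ∘ there))
    clauses✓′ : ∀ {C} → C ∈ₗ map extend (State.clauses s) → ∃ λ c → c ∈ₗ R × Covered ((i , t) ∷ L) C c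
    clauses✓′ C∈ with ∈-map⁻ extend C∈
    ... | C₀ , C₀∈ , refl with clauses✓ C₀∈
    ...   | c , c∈ , cov = c , c∈ , Covered-extend (i , t) c (fixed≤5 ((i , t) ∷ L) M′ coords′ (R⊆A c∈)) cov

  addBlock-sound : ∀ {L M K R s} → Represents L M K R s → ∀ {c} → c ∈ₗ R → Within M c →
    ∃ λ R′ → Represents L M (c ∷ K) R′ (addBlock strict (pull L c) s)
      × (∀ {d} → d ∈ₗ R → d ≢ c → d ≢ antipode c → d ∈ₗ R′)
  addBlock-sound {L} {M} {K} {R} {s} rep {c} c∈ c⊆ = R′ , record
    { coordinates = coordinates
    ; faces       = faces′
    ; within      = within′
    ; blocks≡     = cong (pull L c ∷_) blocks≡
    ; pool✓       = pool✓′
    ; clauses✓    = λ C∈ → clauses✓′ (∈-++⁻ (newClauses (pull L c ∷ State.blocks s) pool′ (pull L c)) C∈)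
    } , stays
    where
    open Represents rep
    open Remainder faces
    removed = removePair faces c∈
    R′ : List (Face n)
    R′ = proj₁ removed
    faces′ : Selected (c ∷ K) R′
    faces′ = proj₁ (proj₂ removed)
    R′⊆R : ∀ {d} → d ∈ₗ R′ → d ∈ₗ R
    R′⊆R = proj₁ (proj₂ (proj₂ removed))
    stays : ∀ {d} → d ∈ₗ R → d ≢ c → d ≢ antipode c → d ∈ₗ R′
    stays = proj₂ (proj₂ (proj₂ removed))
    module ′ = Remainder faces′
    pool′ : Clause
    pool′ = prune strict (pull L c) (State.pool s)
    within′ : ∀ {b} → b ∈ₗ c ∷ K → Within M b
    within′ (here refl) = c⊆
    within′ (there b∈)    = within b∈
    pruned : ∀ {C d} → d ∈ₗ R′ → Covered L C d → Covered L (prune strict (pull L c) C) d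
    pruned d∈ cov with ′.oriented d∈ cov
    ... | d′ , d′∈ , eq , d′∈C = ′.covered eq (∈-filterᵇ⁺ d′∈C
      (compatible-pull L M coordinates (′.R⊆A d′∈) (R⊆A c∈) (′.R≢K d′∈ (here refl)) (′.R≢K̄ d′∈ (here refl)) c⊆))
    pool✓′ : ∀ {d} → d ∈ₗ R′ → Covered L pool′ d
    pool✓′ d∈ = pruned d∈ (pool✓ (R′⊆R d∈))
    new : ∀ {C} → C ∈ₗ newClauses (pull L c ∷ State.blocks s) pool′ (pull L c) → ∃ λ d → d ∈ₗ R′ × Covered L C d
    new {C} C∈ with find∈ (∈-concatMap⁻ (clauseFor (pull L c ∷ State.blocks s) pool′) C∈)
      where
      find∈ : Any (λ p → C ∈ₗ clauseFor (pull L c ∷ State.blocks s) pool′ p) (drops (pull L c)) →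
        ∃ λ p → p ∈ₗ drops (pull L c) × C ∈ₗ clauseFor (pull L c ∷ State.blocks s) pool′ p
      find∈ = find
    ... | P , P∈ , C∈P with drops-pull L c (Unique-++ˡ (vertices L) (Unique-↭ (↭-sym coordinates) (allFin⁺ n))) P∈
    ...   | i , i∈ , fixed , refl = clauseFor-sound L M coordinates faces′ pool✓′ p p⊆ four
              (subst (λ bl → C ∈ₗ clauseFor (pull L c ∷ bl) pool′ (pull L p)) blocks≡ C∈P)
      where
      p : Face n
      p = c [ i ]≔ star
      p⊆ : Within M p
      p⊆ j j∈ = trans (lookup∘update′ (λ j≡i → Unique-++-disjoint (Unique-↭ (↭-sym coordinates)
          (allFin⁺ n)) i∈ j∈ (sym j≡i)) c star) (c⊆ j j∈)
      four : count (fixedIn p) (allFin n) ≡ 4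
      four = ℕₚ.suc-injective (trans (sym (fixedIn-punch c i fixed)) (fixedTotal (R⊆A c∈)))
    -- An old clause keeps its witness: the witness could disappear only by being `c` or its
    -- antipode, and then the clause would contain a pattern with the support of `c` and not be
    -- open.
    old : ∀ {C} → C ∈ₗ map (prune strict (pull L c)) (filterᵇ (isOpen (pull L c)) (State.clauses s)) → ∃ λ d →
        d ∈ₗ R′ × Covered L C d
    old C∈ with ∈-map⁻ (prune strict (pull L c)) C∈
    ... | C₀ , C₀∈ , refl with ∈-filterᵇ⁻ {p = isOpen (pull L c)} C₀∈
    ...   | C₀∈s , openC with clauses✓ C₀∈s
    ...     | d , d∈ , cov with oriented d∈ cov
    ...       | d′ , d′∈ , eq , d′∈C = d′ , d′∈R′ , pruned {C₀} {d′} d′∈R′ (inj₁ d′∈C)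
      where
      unlike : sameSupport (pull L d′) (pull L c) ≡ false
      unlike = any-false {p = λ x → sameSupport x (pull L c)} (trans (sym (not-involutive _)) (cong not openC)) d′∈C
      contradict : ∀ e → (∀ i → fixedIn c i ≡ true → fixedIn e i ≡ true) → d′ ≢ e
      contradict e c⊆e refl with () ← trans (sym unlike) (sameSupport-pull L M coordinates {e} {c} (R⊆A c∈) c⊆e c⊆)
      d′∈R′ : d′ ∈ₗ R′
      d′∈R′ = stays d′∈ (contradict c (λ i fixed → fixed)) (contradict (antipode c)
        (λ i fixed → trans (cong isFixed (lookup-antipode c i)) (trans (isFixed-negEntry (lookup c i)) fixed)))
    clauses✓′ : ∀ {C} → C ∈ₗ newClauses (pull L c ∷ State.blocks s) pool′ (pull L c) ⊎ C ∈ₗ map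
        (prune strict (pull L c)) (filterᵇ (isOpen (pull L c)) (State.clauses s)) →
      ∃ λ d → d ∈ₗ R′ × Covered L C d
    clauses✓′ (inj₁ C∈) = new C∈
    clauses✓′ (inj₂ C∈) = old C∈

  module Search (leaf : List Pattern → Bool) {G : Set}
    (leaf-sound : ∀ L M K → Coordinates L M → Selected K [] → (∀ {b} → b ∈ₗ K → Within M b) → leaf (map (pull L) K) ≡ true → G) where

    -- The given splitting follows a single path through the search tree: each clause, or the pool
    -- when there is no clause, lists a remaining face, and the call for that face is followed.
    -- Hence an empty list of options never occurs on this path, and it can only end at a leaf.
    search-sound : ∀ f {L M K R s} → Represents L M K R s → search leaf strict f s ≡ true → G
    branch-sound : ∀ f {L M K R s} → Represents L M K R s → ∀ {c} → c ∈ₗ R → ∀ C → pull L c ∈ₗ C →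
        branch leaf strict f s C ≡ true → G
    place-sound  : ∀ f k {L M K R s} → Represents L M K R s → ∀ {c} → c ∈ₗ R → k ≡ 5 ∸ fixedCount (pull L c) →
      place leaf strict f k s (pull L c) ≡ true → G

    branch-sound f rep c∈ (u ∷ us) (here refl) ok = place-sound f _ rep c∈ refl (proj₁ (∧-split ok))
    branch-sound f {s = s} rep c∈ (u ∷ us) (there c∈us) ok =
      branch-sound f rep c∈ us c∈us (proj₂ (∧-split {place leaf strict f (5 ∸ fixedCount u) s u} ok))

    place-sound f zero {L} {M} rep {c} c∈ k≡ ok = search-sound f (proj₁ (proj₂ (addBlock-sound rep c∈ c⊆))) ok
      where
      open Represents rep
      open Remainder faces
      total : count (fixedIn c) (vertices L) ℕ.+ count (fixedIn c) M ≡ 5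
      total = trans (count-coordinates L M coordinates (fixedIn c)) (fixedTotal (R⊆A c∈))
      -- With truncated subtraction, `k≡` at zero says that at least five fixed coordinates are
      -- labelled, and there are only five.
      noneLeft : count (fixedIn c) M ≡ 0
      noneLeft = ℕₚ.n≤0⇒n≡0 (ℕₚ.+-cancelˡ-≤ 5 _ _ (ℕₚ.≤-trans (ℕₚ.+-monoˡ-≤ (count (fixedIn c) M)
        (subst (5 ℕ.≤_) (fixedCount-pull L c) (ℕₚ.m∸n≡0⇒m≤n (sym k≡)))) (ℕₚ.≤-reflexive total)))
      c⊆ : Within M c
      c⊆ i i∈ with fixedIn c i in eq
      ... | false = star-unfixed eq
      ... | true with () ← subst (0 ℕ.<_) noneLeft (positive-count i∈ eq)
    place-sound f (suc k) {L} {M} {K} {R} {s} rep {c} c∈ k≡ ok = extendBy (lookup c i) refl (proj₂ (proj₂ new))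
      where
      open Represents rep
      open Remainder faces
      total : count (fixedIn c) (vertices L) ℕ.+ count (fixedIn c) M ≡ 5
      total = trans (count-coordinates L M coordinates (fixedIn c)) (fixedTotal (R⊆A c∈))
      someLeft : 0 ℕ.< count (fixedIn c) M
      someLeft = ℕₚ.+-cancelˡ-< (fixedCount (pull L c)) 0 _ (subst₂ ℕ._<_ (sym (ℕₚ.+-identityʳ _))
        (sym (trans (cong (ℕ._+ count (fixedIn c) M) (fixedCount-pull L c)) total)) (ℕₚ.m∸n≢0⇒n<m {5}
            {fixedCount (pull L c)} (λ ≡0 → ℕₚ.1+n≢0 (trans k≡ ≡0))))
      new : ∃ λ i → i ∈ₗ M × fixedIn c i ≡ true
      new = count-positive M someLeft
      i : Fin n
      i = proj₁ new
      orient-self : ∀ b → orient b (fix b) ≡ fix true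
      orient-self true  = refl
      orient-self false = refl
      extendBy : ∀ e → lookup c i ≡ e → isFixed e ≡ true → G
      -- Taking the entry itself as polarity makes the new coordinate read `true`, as `place`
      -- assumes.
      extendBy (fix b) eq _ = place-sound f k (proj₂ (addCoordinate-sound rep (proj₁ (proj₂ new)) b)) c∈
          (trans (cong ℕ.pred k≡) (trans (ℕₚ.pred[m∸n]≡m∸[1+n] 5 (fixedCount (pull L c)))
              (cong (λ u → 5 ∸ fixedCount u) (sym read≡))))
          (subst (λ u → place leaf strict f k (addCoordinate s) u ≡ true) (sym read≡) ok)
        where
        read≡ : pull ((i , b) ∷ L) c ≡ fix true ∷ pull L c
        read≡ = cong (_∷ pull L c) (trans (cong (orient b) eq) (orient-self b))

    search-sound (suc f) {L} {M} {K} {R} {state bl pool (C ∷ Cs)} rep ok with Represents.clauses✓ rep (shortest-∈ C Cs)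
    ... | c , c∈ , cov with Remainder.oriented (Represents.faces rep) c∈ cov
    ...   | d , d∈ , _ , d∈C = branch-sound f rep d∈ (shortest C Cs) d∈C ok
    search-sound (suc f) {L} {M} {K} {R} {state bl pool []} rep ok = byLength R refl
      where
      open Represents rep
      lengths : length K ℕ.+ (length K ℕ.+ length R) ≡ 2 ^ 5
      lengths = trans (sym (trans (length-++ K) (cong (length K ℕ.+_) (trans (length-++ (map antipode K))
          (cong (ℕ._+ length R) (length-map antipode K))))))
        (trans (↭-length (permutation faces)) size)
      blocks-length : length bl ≡ length K
      blocks-length = trans (cong length blocks≡) (length-map (pull L) K)
      -- The 32 faces consist of `K`, its antipodes and `R`, so `R` is empty exactly when 16 faces
      -- are chosen.
      sixteen : ∀ {k r} → k ℕ.+ (k ℕ.+ r) ≡ 2 ^ 5 → r ≡ 0 → (k ≡ᵇ 16) ≡ true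
      sixteen {k} eq refl = T⇒≡ (ℕₚ.≡⇒≡ᵇ k 16 (ℕₚ.*-cancelˡ-≡ k 16 2 eq))
      remaining : ∀ {k r} → k ℕ.+ (k ℕ.+ suc r) ≡ 2 ^ 5 → (k ≡ᵇ 16) ≡ false
      remaining {k} eq with k ≡ᵇ 16 in k≡
      ... | false = refl
      ... | true rewrite ℕₚ.≡ᵇ⇒≡ k 16 (≡⇒T k≡) with () ← eq
      -- Abstracting the condition lets the `if` inside `ok` be resolved by a proved equation.
      choice : ∀ {b} → (length bl ≡ᵇ 16) ≡ b → (if b then leaf bl else branch leaf strict f
          (state bl pool []) pool) ≡ true
      choice refl = ok
      byLength : ∀ R₀ → R ≡ R₀ → G
      byLength [] R≡ = leaf-sound L M K coordinates (subst (Selected K) R≡ faces) within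
        (trans (cong leaf (sym blocks≡)) (choice (trans (cong (_≡ᵇ 16) blocks-length)
            (sixteen {length K} lengths (cong length R≡)))))
      byLength (c ∷ R₀) R≡ = continue (pool✓ c∈)
        where
        c∈ : c ∈ₗ R
        c∈ = subst (c ∈ₗ_) (sym R≡) (here refl)
        explore : branch leaf strict f (state bl pool []) pool ≡ true
        explore = choice (trans (cong (_≡ᵇ 16) blocks-length) (remaining {length K}
            (trans (cong (λ R → length K ℕ.+ (length K ℕ.+ length R)) (sym R≡)) lengths)))
        continue : Covered L pool c → G
        continue (inj₁ c∈pool) = branch-sound f rep c∈ pool c∈pool explore
        continue (inj₂ c∈pool) = branch-sound f rep (Remainder.R-antipode faces c∈) pool c∈pool explore

-- Final families

any-true : {X : Set} {p : X → Bool} (xs : List X) → any p xs ≡ true → ∃ λ x → x ∈ₗ xs × p x ≡ true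
any-true {p = p} (x ∷ xs) ok with p x in px
... | true  = x , here refl , px
... | false with any-true xs ok
...   | y , y∈ , py = y , there y∈ , py

all-true : {X : Set} {p : X → Bool} {x : X} {xs : List X} → all p xs ≡ true → x ∈ₗ xs → p x ≡ true
all-true {p = p} {xs = y ∷ ys} ok (here refl) = proj₁ (∧-split ok)
all-true {p = p} {xs = y ∷ ys} ok (there x∈)    = all-true (proj₂ (∧-split {p y} ok)) x∈

does-true : {P : Set} (d : Dec P) → does d ≡ true → P
does-true (yes p) _ = p

∈-zip⁻ : {X Y : Set} {x : X} {y : Y} (xs : List X) (ys : List Y) → (x , y) ∈ₗ zip xs ys → x ∈ₗ xs × y ∈ₗ ys
∈-zip⁻ (x ∷ xs) (y ∷ ys) (here refl) = here refl , here refl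
∈-zip⁻ (x ∷ xs) (y ∷ ys) (there xy∈) with ∈-zip⁻ xs ys xy∈
... | x∈ , y∈ = there x∈ , there y∈

zip-partnerˡ : {X Y : Set} {x : X} (xs : List X) (ys : List Y) → length xs ≡ length ys → x ∈ₗ xs → ∃ λ y →
    (x , y) ∈ₗ zip xs ys
zip-partnerˡ (x ∷ xs) (y ∷ ys) eq (here refl) = y , here refl
zip-partnerˡ (x ∷ xs) (y ∷ ys) eq (there x∈) with zip-partnerˡ xs ys (ℕₚ.suc-injective eq) x∈
... | z , z∈ = z , there z∈

zip-partnerʳ : {X Y : Set} {y : Y} (xs : List X) (ys : List Y) → length xs ≡ length ys → y ∈ₗ ys → ∃ λ x →
    (x , y) ∈ₗ zip xs ys
zip-partnerʳ (x ∷ xs) (y ∷ ys) eq (here refl) = x , here refl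
zip-partnerʳ (x ∷ xs) (y ∷ ys) eq (there y∈) with zip-partnerʳ xs ys (ℕₚ.suc-injective eq) y∈
... | z , z∈ = z , there z∈

zip-functional : {X Y : Set} {x : X} {y y′ : Y} (xs : List X) (ys : List Y) → Unique xs →
  (x , y) ∈ₗ zip xs ys → (x , y′) ∈ₗ zip xs ys → y ≡ y′
zip-functional (x ∷ xs) (y ∷ ys) u       (here refl) (here refl) = refl
zip-functional (x ∷ xs) (y ∷ ys) (x∉ ∷ u) (here refl) (there q) = ⊥-elim (All.lookup x∉ (proj₁ (∈-zip⁻ xs ys q)) refl)
zip-functional (x ∷ xs) (y ∷ ys) (x∉ ∷ u) (there p) (here refl) = ⊥-elim (All.lookup x∉ (proj₁ (∈-zip⁻ xs ys p)) refl)
zip-functional (x ∷ xs) (y ∷ ys) (_ ∷ u)  (there p) (there q) = zip-functional xs ys u p q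

zip-injective : {X Y : Set} {x x′ : X} {y : Y} (xs : List X) (ys : List Y) → Unique ys →
  (x , y) ∈ₗ zip xs ys → (x′ , y) ∈ₗ zip xs ys → x ≡ x′
zip-injective (x ∷ xs) (y ∷ ys) u       (here refl) (here refl) = refl
zip-injective (x ∷ xs) (y ∷ ys) (y∉ ∷ u) (here refl) (there q) = ⊥-elim (All.lookup y∉ (proj₂ (∈-zip⁻ xs ys q)) refl)
zip-injective (x ∷ xs) (y ∷ ys) (y∉ ∷ u) (there p) (here refl) = ⊥-elim (All.lookup y∉ (proj₂ (∈-zip⁻ xs ys p)) refl)
zip-injective (x ∷ xs) (y ∷ ys) (_ ∷ u)  (there p) (there q) = zip-injective xs ys u p q

matches-length : ∀ τ u S → matches τ u S ≡ true → length u ≡ length τ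
matches-length []      []          S ok = refl
matches-length (t ∷ τ) (fix _ ∷ u) S ok with lookup S t
... | true  = cong suc (matches-length τ u S ok)
matches-length (t ∷ τ) (star ∷ u)  S ok with lookup S t
... | false = cong suc (matches-length τ u S ok)

matches-pull : ∀ {n} τ (L : List (Literal n)) a S → matches τ (pull L a) S ≡ true →
  ∀ {i t} → (i , t) ∈ₗ zip (vertices L) τ → fixedIn a i ≡ lookup S t
matches-pull (t ∷ τ) ((i , s) ∷ L) a S ok it∈ with orient s (lookup a i) | isFixed-orient s (lookup a i)
matches-pull (t ∷ τ) ((i , s) ∷ L) a S ok it∈ | fix _ | fixed with lookup S t in S[t]
matches-pull (t ∷ τ) ((i , s) ∷ L) a S ok (here refl) | fix _ | fixed | true = trans (sym fixed) (sym S[t])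
matches-pull (t ∷ τ) ((i , s) ∷ L) a S ok (there it∈)   | fix _ | fixed | true = matches-pull τ L a S ok it∈
matches-pull (t ∷ τ) ((i , s) ∷ L) a S ok it∈ | star | fixed with lookup S t in S[t]
matches-pull (t ∷ τ) ((i , s) ∷ L) a S ok (here refl) | star | fixed | false = trans (sym fixed) (sym S[t])
matches-pull (t ∷ τ) ((i , s) ∷ L) a S ok (there it∈)   | star | fixed | false = matches-pull τ L a S ok it∈

β-antipode : ∀ {n} (a : Face n) → β (antipode a) ≡ β a
β-antipode []      = refl
β-antipode (e ∷ a) = cong₂ _∷_ (isFixed-negEntry e) (β-antipode a)

module Certified {n : ℕ} {A : List (Face n)} (L : List (Literal n)) (M : List (Fin n)) (K : List (Face n))
  (coords : vertices L ++ M ↭ allFin n) (faces : K ++ (map antipode K ++ []) ↭ A)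
  (within : ∀ {b} → b ∈ₗ K → ∀ i → i ∈ₗ M → lookup b i ≡ star)
  (T : List (Subset 8)) (S₀ : Subset 8) (S₀∈T : S₀ ∈ₗ T) (τ : Labelling) (ok : certifies T (map (pull L) K) τ ≡ true) where

  surjective : Bool
  surjective = all (λ t → does (t ∈? τ)) (allFin 8)

  allBlocks allSets : Bool
  allBlocks = all (λ u → any (matches τ u) T) (map (pull L) K)
  allSets   = all (λ S → any (λ u → matches τ u S) (map (pull L) K)) T

  isLabelling : does (unique? τ) ≡ true × surjective ≡ true
  isLabelling = ∧-split {does (unique? τ)} {surjective} (proj₁ (∧-split {does (unique? τ) ∧ surjective}
      {allBlocks ∧ allSets} ok))

  bothWays : allBlocks ≡ true × allSets ≡ true
  bothWays = ∧-split {allBlocks} {allSets} (proj₂ (∧-split {does (unique? τ) ∧ surjective} {allBlocks ∧ allSets} ok))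

  uniqueτ : Unique τ
  uniqueτ = does-true (unique? τ) (proj₁ isLabelling)

  uniqueL : Unique (vertices L)
  uniqueL = Unique-++ˡ (vertices L) (Unique-↭ (↭-sym coords) (allFin⁺ n))

  fromBlock : ∀ {b} → b ∈ₗ K → ∃ λ S → S ∈ₗ T × matches τ (pull L b) S ≡ true
  fromBlock b∈ = any-true T (all-true {p = λ u → any (matches τ u) T} (proj₁ bothWays) (∈-map⁺ (pull L) b∈))

  toBlock : ∀ {S} → S ∈ₗ T → ∃ λ b → b ∈ₗ K × matches τ (pull L b) S ≡ true
  toBlock {S} S∈ with any-true (map (pull L) K) (all-true {p = λ S → any (λ u → matches τ u S)
      (map (pull L) K)} (proj₂ bothWays) S∈)
  ... | u , u∈ , m with ∈-map⁻ (pull L) u∈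
  ...   | b , b∈ , refl = b , b∈ , m

  -- `zip` truncates silently, so equal lengths have to be known. One successful `matches` implies
  -- them, and `S₀` guarantees that there is one.
  lengths : length (vertices L) ≡ length τ
  lengths with toBlock S₀∈T
  ... | b , _ , m = trans (length-map proj₁ L) (trans (sym (length-map (read b) L)) (matches-length τ (pull L b) S₀ m))

  partner : (t : Fin 8) → ∃ λ i → (i , t) ∈ₗ zip (vertices L) τ
  partner t = zip-partnerʳ (vertices L) τ lengths (does-true (t ∈? τ) (all-true {p = λ t → does (t ∈? τ)}
      (proj₂ isLabelling) (∈-allFin t)))

  embedding : Fin 8 → Fin n
  embedding t = proj₁ (partner t)

  embedding-injective : ∀ {t t′} → embedding t ≡ embedding t′ → t ≡ t′
  embedding-injective {t} {t′} eq = zip-functional (vertices L) τ uniqueL (proj₂ (partner t))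
    (subst (λ i → (i , t′) ∈ₗ zip (vertices L) τ) (sym eq) (proj₂ (partner t′)))

  -- A coordinate fixed in `b` is labelled because of `within`, so it has a partner in `Fin 8`; at
  -- labelled coordinates `matches` has compared membership.
  image : ∀ {b S} → b ∈ₗ K → matches τ (pull L b) S ≡ true → IsImage embedding S (β b)
  image {b} {S} b∈ m i = mk⇔ to from
    where
    β[i] : lookup (β b) i ≡ fixedIn b i
    β[i] = lookup-map i isFixed b
    to : i ∈ₛ β b → ∃ λ t → t ∈ₛ S × embedding t ≡ i
    to i∈ = split (∈-++⁻ (vertices L) (∈-resp-↭ (↭-sym coords) (∈-allFin i)))
      where
      fixed : fixedIn b i ≡ true
      fixed = trans (sym β[i]) ([]=⇒lookup i∈)
      split : i ∈ₗ vertices L ⊎ i ∈ₗ M → ∃ λ t → t ∈ₛ S × embedding t ≡ i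
      split (inj₂ i∈M) with () ← trans (sym fixed) (cong isFixed (within b∈ i i∈M))
      split (inj₁ i∈L) with zip-partnerˡ (vertices L) τ lengths i∈L
      ... | t , it∈ = t , lookup⇒[]= t S (trans (sym (matches-pull τ L b S m it∈)) fixed) ,
                      zip-injective (vertices L) τ uniqueτ (proj₂ (partner t)) it∈
    from : (∃ λ t → t ∈ₛ S × embedding t ≡ i) → i ∈ₛ β b
    from (t , t∈ , refl) = lookup⇒[]= i (β b) (trans β[i] (trans (matches-pull τ L b S m (proj₂ (partner t)))
        ([]=⇒lookup t∈)))

  -- No face is left outside `K` and its antipodes, and antipodal faces have the same block, so the
  -- blocks of `K` exhaust `βColl A`.
  equivalence : EquivVia (listColl T) (βColl A)
  equivalence = embedding , embedding-injective , covers , λ S S∈ → hit (toBlock S∈)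
    where
    block : ∀ {b} → b ∈ₗ K → ∃ λ S → S ∈ₗ T × IsImage embedding S (β b)
    block b∈ with fromBlock b∈
    ... | S , S∈ , m = S , S∈ , image b∈ m
    fromFace : ∀ {a} → a ∈ₗ K ⊎ a ∈ₗ map antipode K ++ [] → ∃ λ S → S ∈ₗ T × IsImage embedding S (β a)
    fromFace (inj₁ a∈) = block a∈
    fromFace (inj₂ a∈) with ∈-++⁻ (map antipode K) a∈
    ... | inj₁ ā∈ with ∈-map⁻ antipode ā∈
    ...   | b , b∈ , refl = subst (λ X → ∃ λ S → S ∈ₗ T × IsImage embedding S X) (sym (β-antipode b)) (block b∈)
    covers : ∀ U → βColl A U → ∃ λ S → listColl T S × IsImage embedding S U
    covers U (a , a∈ , refl) = fromFace (∈-++⁻ K (∈-resp-↭ (↭-sym faces) a∈))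
    hit : ∀ {S} → (∃ λ b → b ∈ₗ K × matches τ (pull L b) S ≡ true) → ∃ λ U → βColl A U × IsImage embedding S U
    hit (b , b∈ , m) = β b , (b , ∈-resp-↭ faces (∈-++⁺ˡ b∈) , refl) , image b∈ m

∨-split : ∀ {a b} → a ∨ b ≡ true → a ≡ true ⊎ b ≡ true
∨-split {true}  _  = inj₁ refl
∨-split {false} ok = inj₂ ok

module Leaf {n : ℕ} {A : List (Face n)} (L : List (Literal n)) (M : List (Fin n)) (K : List (Face n))
  (coords : vertices L ++ M ↭ allFin n) (faces : K ++ (map antipode K ++ []) ↭ A)
  (within : ∀ {b} → b ∈ₗ K → ∀ i → i ∈ₗ M → lookup b i ≡ star) where

  isomorphic-sound : ∀ T {S₀} → S₀ ∈ₗ T → isomorphic T (map (pull L) K) ≡ true → EquivVia (listColl T) (βColl A)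
  isomorphic-sound T S₀∈T iso = Certified.equivalence L M K coords faces within T _ S₀∈T
      (map proj₂ (proj₁ found)) (proj₂ (proj₂ found))
    where
    found : ∃ λ ls → ls ∈ₗ labellings (incidence T) (columns 8 (map (pull L) K)) × certifies T
        (map (pull L) K) (map proj₂ ls) ≡ true
    found = any-true {p = λ ls → certifies T (map (pull L) K) (map proj₂ ls)} (labellings (incidence T)
        (columns 8 (map (pull L) K))) iso

  leaf-sound : leaf (map (pull L) K) ≡ true → Equivalent (βColl A) E ⊎ Equivalent (βColl A) F
  leaf-sound ok = conclude (∨-split {isomorphic Elist (map (pull L) K)} {isomorphic Flist (map (pull L) K)} ok)
    where
    conclude : isomorphic Elist (map (pull L) K) ≡ true ⊎ isomorphic Flist (map (pull L) K) ≡ true →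
        Equivalent (βColl A) E ⊎ Equivalent (βColl A) F
    -- The injection runs from the eight points of the listed family into `Fin n`, which is the
    -- reverse alternative of `Equivalent`.
    conclude (inj₁ iso) = inj₁ (inj₂ (isomorphic-sound Elist (here refl) iso))
    conclude (inj₂ iso) = inj₂ (inj₂ (isomorphic-sound Flist (here refl) iso))

-- The initial pair of faces

data Class : Set where
  onlySecond onlyFirst common opposed neither : Class

classify : Entry → Entry → Class
classify star        star        = neither
classify star        (fix _)     = onlySecond
classify (fix _)     star        = onlyFirst
classify (fix true)  (fix true)  = common
classify (fix true)  (fix false) = opposed
classify (fix false) (fix true)  = opposed
classify (fix false) (fix false) = common

is : Class → Class → Bool
is onlySecond onlySecond = true
is onlyFirst  onlyFirst  = true
is common     common     = true
is opposed    opposed    = true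
is neither    neither    = true
is _          _          = false

select : {X : Set} → (X → Class) → Class → List X → List X
select κ k []       = []
select κ k (x ∷ xs) = if is k (κ x) then x ∷ select κ k xs else select κ k xs

select-↭ : {X : Set} (κ : X → Class) (xs : List X) →
  xs ↭ select κ onlySecond xs ++ (select κ onlyFirst xs ++ (select κ common xs ++
      (select κ opposed xs ++ select κ neither xs)))
select-↭ κ []       = Perm.refl
select-↭ κ (x ∷ xs) with κ x | select-↭ κ xs
... | onlySecond | p = Perm.prep x p
... | onlyFirst  | p = ↭-trans (Perm.prep x p) (↭-sym (shift x (select κ onlySecond xs) _))
... | common     | p = ↭-trans (Perm.prep x p) (↭-trans (↭-sym (shift x (select κ onlySecond xs) _))
                         (++⁺ˡ (select κ onlySecond xs) (↭-sym (shift x (select κ onlyFirst xs) _))))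
... | opposed    | p = ↭-trans (Perm.prep x p) (↭-trans (↭-sym (shift x (select κ onlySecond xs) _))
                         (++⁺ˡ (select κ onlySecond xs) (↭-trans (↭-sym (shift x (select κ onlyFirst xs) _))
                         (++⁺ˡ (select κ onlyFirst xs) (↭-sym (shift x (select κ common xs) _))))))
... | neither    | p = ↭-trans (Perm.prep x p) (↭-trans (↭-sym (shift x (select κ onlySecond xs) _))
                         (++⁺ˡ (select κ onlySecond xs) (↭-trans (↭-sym (shift x (select κ onlyFirst xs) _))
                         (++⁺ˡ (select κ onlyFirst xs) (↭-trans (↭-sym (shift x (select κ common xs) _))
                         (++⁺ˡ (select κ common xs) (↭-sym (shift x (select κ opposed xs) _))))))))

select-length : {X : Set} (κ : X → Class) (k : Class) (xs : List X) → length (select κ k xs) ≡ count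
    (λ x → is k (κ x)) xs
select-length κ k []       = refl
select-length κ k (x ∷ xs) with is k (κ x)
... | true  = cong suc (select-length κ k xs)
... | false = select-length κ k xs

select-class : {X : Set} (κ : X → Class) (k : Class) {x : X} (xs : List X) → x ∈ₗ select κ k xs → is k (κ x) ≡ true
select-class κ k (y ∷ ys) x∈ with is k (κ y) in eq
select-class κ k (y ∷ ys) (here refl) | true  = eq
select-class κ k (y ∷ ys) (there x∈)    | true  = select-class κ k ys x∈
select-class κ k (y ∷ ys) x∈            | false = select-class κ k ys x∈

polarity : Entry → Bool
polarity (fix b) = b
polarity star    = true

map-constant : {X Y : Set} (f : X → Y) (y : Y) (xs : List X) → (∀ x → x ∈ₗ xs → f x ≡ y) → map f xs
    ≡ replicate (length xs) y
map-constant f y []       h = refl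
map-constant f y (x ∷ xs) h = cong₂ _∷_ (h x (here refl)) (map-constant f y xs (λ z → h z ∘ there))

vertices-literals : ∀ {n} (s : Fin n → Bool) xs → vertices (map (λ i → i , s i) xs) ≡ xs
vertices-literals s []       = refl
vertices-literals s (x ∷ xs) = cong (x ∷_) (vertices-literals s xs)

-- `r`, `f`, `g`, `d` count the coordinates fixed only in the second face, fixed only in the first,
-- agreeing and disagreeing. Up to reordering and reflecting coordinates they determine the pair.
profileFirst profileSecond : (r f g d : ℕ) → Pattern
profileFirst  r f g d = replicate r star ++ (replicate f (fix true) ++ (replicate g (fix true) ++ replicate d
    (fix true)))
profileSecond r f g d = replicate r (fix true) ++ (replicate f star ++ (replicate g (fix true) ++ replicate d
    (fix false)))

module Alignment {n : ℕ} (b c : Face n) where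
  κ : Fin n → Class
  κ i = classify (lookup b i) (lookup c i)

  group : Class → List (Fin n)
  group k = select κ k (allFin n)

  firstPolarity secondPolarity : Fin n → Bool
  firstPolarity  i = polarity (lookup b i)
  secondPolarity i = polarity (lookup c i)

  -- Polarities follow the first face where it is fixed and the second face elsewhere, so every
  -- fixed entry reads `true` except those of the second face at disagreements.
  literals : List (Literal n)
  literals = map (λ i → i , secondPolarity i) (group onlySecond)
    ++ map (λ i → i , firstPolarity i) (group onlyFirst ++ (group common ++ group opposed))

  outside : List (Fin n)
  outside = group neither

  coordinates : vertices literals ++ outside ↭ allFin n
  coordinates = subst (_↭ allFin n) (sym regrouped) (↭-sym (select-↭ κ (allFin n)))
    where
    regrouped : vertices literals ++ outside ≡ group onlySecond ++ (group onlyFirst ++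
        (group common ++ (group opposed ++ group neither)))
    regrouped = trans (cong (_++ outside) (trans (map-++ proj₁ (map (λ i → i , secondPolarity i) (group onlySecond)) _)
                  (cong₂ _++_ (vertices-literals secondPolarity (group onlySecond))
                      (vertices-literals firstPolarity _))))
      (trans (++-assoc (group onlySecond) _ outside) (cong (group onlySecond ++_)
      (trans (++-assoc (group onlyFirst) _ outside) (cong (group onlyFirst ++_) (++-assoc (group common)
          (group opposed) outside)))))

  outside-first : ∀ i → i ∈ₗ outside → lookup b i ≡ star
  outside-first i i∈ with lookup b i | lookup c i | select-class κ neither (allFin n) i∈
  ... | star      | star      | _  = refl
  ... | fix true  | fix true  | ()
  ... | fix true  | fix false | ()
  ... | fix false | fix true  | ()
  ... | fix false | fix false | ()

  outside-second : ∀ i → i ∈ₗ outside → lookup c i ≡ star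
  outside-second i i∈ with lookup b i | lookup c i | select-class κ neither (allFin n) i∈
  ... | star      | star      | _  = refl
  ... | fix true  | fix true  | ()
  ... | fix true  | fix false | ()
  ... | fix false | fix true  | ()
  ... | fix false | fix false | ()

  groupSize : Class → ℕ
  groupSize k = length (group k)

  segment : ∀ a (s : Fin n → Bool) k e → (∀ i → is k (κ i) ≡ true → orient (s i) (lookup a i) ≡ e) →
    map (read a) (map (λ i → i , s i) (group k)) ≡ replicate (groupSize k) e
  segment a s k e h = trans (sym (map-∘ (group k))) (map-constant _ e (group k)
      (λ i i∈ → h i (select-class κ k (allFin n) i∈)))

  pull-segments : ∀ a e₁ e₂ e₃ e₄ →
    (∀ i → is onlySecond (κ i) ≡ true → orient (secondPolarity i) (lookup a i) ≡ e₁) →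
    (∀ i → is onlyFirst (κ i) ≡ true → orient (firstPolarity i) (lookup a i) ≡ e₂) →
    (∀ i → is common (κ i) ≡ true → orient (firstPolarity i) (lookup a i) ≡ e₃) →
    (∀ i → is opposed (κ i) ≡ true → orient (firstPolarity i) (lookup a i) ≡ e₄) →
    pull literals a ≡ replicate (groupSize onlySecond) e₁ ++ (replicate (groupSize onlyFirst) e₂ ++
        (replicate (groupSize common) e₃ ++ replicate (groupSize opposed) e₄))
  pull-segments a e₁ e₂ e₃ e₄ h₁ h₂ h₃ h₄ =
    trans (map-++ (read a) (map (λ i → i , secondPolarity i) (group onlySecond)) _)
      (cong₂ _++_ (segment a secondPolarity onlySecond e₁ h₁)
          (trans (cong (map (read a)) (map-++ lit (group onlyFirst) _))
        (trans (map-++ (read a) (map lit (group onlyFirst)) _)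
          (cong₂ _++_ (segment a firstPolarity onlyFirst e₂ h₂)
              (trans (cong (map (read a)) (map-++ lit (group common) _))
            (trans (map-++ (read a) (map lit (group common)) _)
              (cong₂ _++_ (segment a firstPolarity common e₃ h₃) (segment a firstPolarity opposed e₄ h₄))))))))
    where
    lit : Fin n → Literal n
    lit i = i , firstPolarity i

  pull-first : pull literals b ≡ profileFirst (groupSize onlySecond) (groupSize onlyFirst) (groupSize common)
      (groupSize opposed)
  pull-first = pull-segments b star (fix true) (fix true) (fix true)
    (λ i → h₁ (lookup b i) (lookup c i)) (λ i → h₂ (lookup b i) (lookup c i)) (λ i → h₃ (lookup b i)
        (lookup c i)) (λ i → h₄ (lookup b i) (lookup c i))
    where
    h₁ : ∀ e d → is onlySecond (classify e d) ≡ true → orient (polarity d) e ≡ star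
    h₁ star (fix true)  _ = refl
    h₁ star (fix false) _ = refl
    h₁ (fix true)  (fix true)  ()
    h₁ (fix true)  (fix false) ()
    h₁ (fix false) (fix true)  ()
    h₁ (fix false) (fix false) ()
    self : ∀ b → orient b (fix b) ≡ fix true
    self true  = refl
    self false = refl
    h₂ : ∀ e d → is onlyFirst (classify e d) ≡ true → orient (polarity e) e ≡ fix true
    h₂ (fix x) star _ = self x
    h₂ (fix x) (fix _) _ = self x
    h₃ : ∀ e d → is common (classify e d) ≡ true → orient (polarity e) e ≡ fix true
    h₃ (fix x) d _ = self x
    h₃ star star ()
    h₃ star (fix _) ()
    h₄ : ∀ e d → is opposed (classify e d) ≡ true → orient (polarity e) e ≡ fix true
    h₄ (fix x) d _ = self x
    h₄ star star ()
    h₄ star (fix _) ()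

  pull-second : pull literals c ≡ profileSecond (groupSize onlySecond) (groupSize onlyFirst)
      (groupSize common) (groupSize opposed)
  pull-second = pull-segments c (fix true) star (fix true) (fix false)
    (λ i → h₁ (lookup b i) (lookup c i)) (λ i → h₂ (lookup b i) (lookup c i)) (λ i → h₃ (lookup b i)
        (lookup c i)) (λ i → h₄ (lookup b i) (lookup c i))
    where
    self : ∀ b → orient b (fix b) ≡ fix true
    self true  = refl
    self false = refl
    h₁ : ∀ e d → is onlySecond (classify e d) ≡ true → orient (polarity d) d ≡ fix true
    h₁ e    (fix x) _ = self x
    h₁ star star ()
    h₂ : ∀ e d → is onlyFirst (classify e d) ≡ true → orient (polarity e) d ≡ star
    h₂ (fix true)  star _ = refl
    h₂ (fix false) star _ = refl
    h₂ (fix true)  (fix true)  ()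
    h₂ (fix true)  (fix false) ()
    h₂ (fix false) (fix true)  ()
    h₂ (fix false) (fix false) ()
    h₃ : ∀ e d → is common (classify e d) ≡ true → orient (polarity e) d ≡ fix true
    h₃ (fix true)  (fix true)  _ = refl
    h₃ (fix false) (fix false) _ = refl
    h₃ star star ()
    h₃ star (fix _) ()
    h₄ : ∀ e d → is opposed (classify e d) ≡ true → orient (polarity e) d ≡ fix false
    h₄ (fix true)  (fix false) _ = refl
    h₄ (fix false) (fix true)  _ = refl
    h₄ star star ()
    h₄ star (fix _) ()

  groupSize-common : groupSize common ≡ count (agreeIn b c) (allFin n)
  groupSize-common = trans (select-length κ common (allFin n)) (count-cong (allFin n) (λ i _ → h (lookup b i)
      (lookup c i)))
    where
    h : ∀ e d → is common (classify e d) ≡ agreeing e d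
    h star        star        = refl
    h star        (fix _)     = refl
    h (fix true)  star        = refl
    h (fix false) star        = refl
    h (fix true)  (fix true)  = refl
    h (fix true)  (fix false) = refl
    h (fix false) (fix true)  = refl
    h (fix false) (fix false) = refl

  groupSize-opposed : groupSize opposed ≡ count (disagreeIn b c) (allFin n)
  groupSize-opposed = trans (select-length κ opposed (allFin n)) (count-cong (allFin n)
      (λ i _ → h (lookup b i) (lookup c i)))
    where
    h : ∀ e d → is opposed (classify e d) ≡ disagreeing e d
    h star        star        = refl
    h star        (fix _)     = refl
    h (fix true)  star        = refl
    h (fix false) star        = refl
    h (fix true)  (fix true)  = refl
    h (fix true)  (fix false) = refl
    h (fix false) (fix true)  = refl
    h (fix false) (fix false) = refl

  bothFixed : Fin n → Bool
  bothFixed i = fixedIn b i ∧ fixedIn c i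

  groupSize-onlyFirst : count bothFixed (allFin n) ℕ.+ groupSize onlyFirst ≡ count (fixedIn b) (allFin n)
  groupSize-onlyFirst = trans (cong (count bothFixed (allFin n) ℕ.+_) (select-length κ onlyFirst (allFin n)))
    (count-+ (allFin n) (λ i → h (lookup b i) (lookup c i)))
    where
    h : ∀ e d → (if isFixed e ∧ isFixed d then suc else id) (if is onlyFirst (classify e d) then 1 else 0) ≡
        (if isFixed e then 1 else 0)
    h star        star        = refl
    h star        (fix _)     = refl
    h (fix true)  star        = refl
    h (fix false) star        = refl
    h (fix true)  (fix true)  = refl
    h (fix true)  (fix false) = refl
    h (fix false) (fix true)  = refl
    h (fix false) (fix false) = refl

  groupSize-onlySecond : count bothFixed (allFin n) ℕ.+ groupSize onlySecond ≡ count (fixedIn c) (allFin n)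
  groupSize-onlySecond = trans (cong (count bothFixed (allFin n) ℕ.+_) (select-length κ onlySecond (allFin n)))
    (count-+ (allFin n) (λ i → h (lookup b i) (lookup c i)))
    where
    h : ∀ e d → (if isFixed e ∧ isFixed d then suc else id) (if is onlySecond (classify e d) then 1 else 0) ≡
        (if isFixed d then 1 else 0)
    h star        star        = refl
    h star        (fix _)     = refl
    h (fix true)  star        = refl
    h (fix false) star        = refl
    h (fix true)  (fix true)  = refl
    h (fix true)  (fix false) = refl
    h (fix false) (fix true)  = refl
    h (fix false) (fix false) = refl

-- Starting the search and the final case distinction

count-tail : {X : Set} (f : X → Bool) (x : X) (xs : List X) → count f xs ℕ.≤ count f (x ∷ xs)
count-tail f x xs with f x
... | true  = ℕₚ.n≤1+n _
... | false = ℕₚ.≤-refl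

poolOf-covers : ∀ {n} (L : List (Literal n)) c → count (fixedIn c) (vertices L) ℕ.≤ 5 → Covered L (poolOf (length L)) c
poolOf-covers []      c le = inj₁ (here refl)
poolOf-covers (l ∷ L) c le = Covered-extend l c le (poolOf-covers L c (ℕₚ.≤-trans (count-tail (fixedIn c)
    (proj₁ l) (vertices L)) le))

disagreeing-self : ∀ e → disagreeing e e ≡ false
disagreeing-self star        = refl
disagreeing-self (fix true)  = refl
disagreeing-self (fix false) = refl

disagreement⇒≢ : ∀ {n} {b c : Face n} → 1 ℕ.≤ count (disagreeIn b c) (allFin n) → c ≢ b
disagreement⇒≢ {n} {b} some refl = ℕₚ.<⇒≢ some (sym (count-none (allFin n) (λ i _ → disagreeing-self (lookup b i))))

agreement⇒≢ : ∀ {n} {b c : Face n} → 1 ℕ.≤ count (agreeIn b c) (allFin n) → c ≢ antipode b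
agreement⇒≢ {n} {b} some refl = ℕₚ.<⇒≢ some (sym (count-none (allFin n) (λ i _ →
  trans (cong (agreeing (lookup b i)) (lookup-antipode b i)) (trans (agreeing-neg (lookup b i) (lookup b i))
      (disagreeing-self (lookup b i))))))

-- A record, so that comparing two such types never runs the search.
record Explored (strict : Bool) (g d : ℕ) : Set where
  constructor explored
  field succeeds : search leaf strict 17 (start strict (profileFirst 1 1 g d) (profileSecond 1 1 g d)) ≡ true

-- `refl` evaluates the search. Success may come from closed branches or from leaves isomorphic to
-- `E` or `F`; either suffices. The fuel 17 covers the 14 faces still to be chosen and the final
-- test, and exhausted fuel would give `false`.
balanced-explored : Explored false 2 2
balanced-explored = explored refl

unbalanced-explored : Explored true 3 1
unbalanced-explored = explored refl

module Conclusion {n : ℕ} (n≥5 : n ≥ 5) {A : List (Face n)} (S : AntipodalSplitting n 5 A) where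
  open AntipodalSplitting S using (covers)
  open Partition n≥5 S
  open Faces n≥5 S

  Goal : Set
  Goal = Equivalent (βColl A) E ⊎ Equivalent (βColl A) F

  module _ (strict : Bool) (unbalanced : strict ≡ true → ∀ {a b} → a ∈ₗ A → b ∈ₗ A →
     ¬ (count (agreeIn a b) (allFin n) ≡ 2 × count (disagreeIn a b) (allFin n) ≡ 2)) where
    open Soundness n≥5 S strict unbalanced
    open Search leaf {Goal} (λ L M K coords faces within → Leaf.leaf-sound L M K coords
        (Selected.permutation faces) within)

    -- Four common coordinates leave one further fixed coordinate to each face, so the aligned pair
    -- is literally the pair of profiles from which the evaluated search starts.
    start-sound : ∀ {b c} → b ∈ₗ A → c ∈ₗ A → ∀ g d → count (agreeIn b c) (allFin n) ≡ suc g → count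
        (disagreeIn b c) (allFin n) ≡ suc d →
      suc g ℕ.+ suc d ≡ 4 → length (profileFirst 1 1 (suc g) (suc d)) ≡ 6 →
      Explored strict (suc g) (suc d) → Goal
    start-sound {b} {c} b∈ c∈ g d agree≡ disagree≡ four six (explored ok) = search-sound 17 second
      (subst₂ (λ u v → search leaf strict 17 (start strict u v) ≡ true) (sym first≡) (sym second≡) ok)
      where
      open Alignment b c
      both≡4 : count bothFixed (allFin n) ≡ 4
      both≡4 = trans (sym (agree≤fixed b c (allFin n))) (trans (cong₂ ℕ._+_ agree≡ disagree≡) four)
      one : ∀ {x y z} → x ≡ 4 → x ℕ.+ y ≡ z → z ≡ 5 → y ≡ 1
      one refl eq refl = ℕₚ.+-cancelˡ-≡ 4 _ 1 eq
      onlySecond≡1 : groupSize onlySecond ≡ 1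
      onlySecond≡1 = one both≡4 groupSize-onlySecond (fixedTotal c∈)
      onlyFirst≡1 : groupSize onlyFirst ≡ 1
      onlyFirst≡1 = one both≡4 groupSize-onlyFirst (fixedTotal b∈)
      profile : ∀ {r f x y} (P : (r f g d : ℕ) → Pattern) → r ≡ 1 → f ≡ 1 → x ≡ suc g → y ≡ suc d → P r f x y
          ≡ P 1 1 (suc g) (suc d)
      profile P refl refl refl refl = refl
      first≡ : pull literals b ≡ profileFirst 1 1 (suc g) (suc d)
      first≡ = trans pull-first (profile profileFirst onlySecond≡1 onlyFirst≡1 (trans groupSize-common agree≡)
          (trans groupSize-opposed disagree≡))
      second≡ : pull literals c ≡ profileSecond 1 1 (suc g) (suc d)
      second≡ = trans pull-second (profile profileSecond onlySecond≡1 onlyFirst≡1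
          (trans groupSize-common agree≡) (trans groupSize-opposed disagree≡))
      literals-length : length literals ≡ 6
      literals-length = trans (sym (length-map (read b) literals)) (trans (cong length first≡) six)
      initial : Represents literals outside [] A (state [] (poolOf 6) [])
      initial = record
        { coordinates = coordinates
        ; faces       = selected Perm.refl
        ; within      = λ ()
        ; blocks≡     = refl
        ; pool✓       = λ {a} a∈ → subst (λ k → Covered literals (poolOf k) a) literals-length
            (poolOf-covers literals a (fixed≤5 literals outside coordinates a∈))
        ; clauses✓    = λ ()
        }
      first = addBlock-sound initial b∈ outside-first
      second = proj₁ (proj₂ (addBlock-sound (proj₁ (proj₂ first))
        (proj₂ (proj₂ first) c∈ (disagreement⇒≢ {b = b} (subst (1 ℕ.≤_) (sym disagree≡) (ℕ.s≤s ℕ.z≤n)))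
            (agreement⇒≢ {b = b} (subst (1 ℕ.≤_) (sym agree≡) (ℕ.s≤s ℕ.z≤n))))
        outside-second))

  -- Freeing `i` in `b` gives a reference on four coordinates where `b` and its antipode are both
  -- positive. Cancellation yields `c` with negative sign: it is neither of them, and it fixes all
  -- four coordinates, so the overlap is exactly 4.
  neighbour : ∀ {b} → b ∈ₗ A → (i : Fin n) → fixedIn b i ≡ true → ∃ λ c → c ∈ₗ A × 1 ℕ.≤ count (agreeIn b c)
      (allFin n) × 1 ℕ.≤ count (disagreeIn b c) (allFin n)
    × count (agreeIn b c) (allFin n) ℕ.+ count (disagreeIn b c) (allFin n) ≡ 4
  neighbour {b} b∈ i fixed[i] = c , c∈ , some-agreement b∈ c∈ b≢c̄ , some-disagreement b∈ c∈ b≢c , ℕₚ.≤-antisym (overlap≤4 b∈ c∈ b≢c b≢c̄) 4≤overlap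
    where
    p : Face n
    p = b [ i ]≔ star
    four : count (fixedIn p) (allFin n) ≡ 4
    four = ℕₚ.suc-injective (trans (sym (fixedIn-punch b i fixed[i])) (fixedTotal b∈))
    someFixed : ∃ λ j → j ∈ₗ allFin n × fixedIn p j ≡ true
    someFixed = count-positive (allFin n) (subst (0 ℕ.<_) (sym four) (ℕ.s≤s ℕ.z≤n))
    restricts : ∀ j → lookup p j ≡ star ⊎ lookup p j ≡ lookup b j
    restricts j with j ≟ᶠ i
    ... | yes refl = inj₁ (lookup∘update j b star)
    ... | no  j≢i    = inj₂ (lookup∘update′ j≢i b star)
    positive : 0ℤ < faceSign p b
    positive = faceSign-restriction p b restricts
    opposite : ∃ λ c → c ∈ₗ A × faceSign p c < 0ℤ
    opposite = oppositeSign p (proj₁ someFixed) (proj₂ (proj₂ someFixed)) b∈ positive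
    c : Face n
    c = proj₁ opposite
    c∈ : c ∈ₗ A
    c∈ = proj₁ (proj₂ opposite)
    negative : faceSign p c < 0ℤ
    negative = proj₂ (proj₂ opposite)
    b≢c : b ≢ c
    b≢c b≡c = <-asym negative (subst (λ x → 0ℤ < faceSign p x) b≡c positive)
    b≢c̄ : b ≢ antipode c
    b≢c̄ b≡c̄ = <-asym negative (subst (0ℤ <_) (trans (cong (faceSign p) b≡c̄) (faceSign-antipode p c four)) positive)
    4≤overlap : 4 ℕ.≤ count (agreeIn b c) (allFin n) ℕ.+ count (disagreeIn b c) (allFin n)
    4≤overlap = subst₂ ℕ._≤_ four (sym (agree≤fixed b c (allFin n))) (count-≤ (allFin n) both)
      where
      ∧-true : ∀ {x y} → x ≡ true → y ≡ true → x ∧ y ≡ true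
      ∧-true refl refl = refl
      unstar : ∀ j → fixedIn p j ≡ true → lookup p j ≡ star ⊎ lookup p j ≡ lookup b j → fixedIn b j ≡ true
      unstar j fixed (inj₁ isStar) with () ← trans (sym fixed) (cong isFixed isStar)
      unstar j fixed (inj₂ same)   = trans (cong isFixed (sym same)) fixed
      both : ∀ j → fixedIn p j ≡ true → fixedIn b j ∧ fixedIn c j ≡ true
      both j fixed = ∧-true (unstar j fixed (restricts j))
        (signProduct-fixed {f = lookup p} {lookup c}
            (λ ≡0 → <-irrefl (trans (faceSign-allFin p c) ≡0) negative) j (∈-allFin j) fixed)

  agree-antipode : ∀ b c → count (agreeIn b (antipode c)) (allFin n) ≡ count (disagreeIn b c) (allFin n)
  agree-antipode b c = count-cong (allFin n) (λ i _ → trans (cong (agreeing (lookup b i))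
      (lookup-antipode c i)) (agreeing-neg (lookup b i) (lookup c i)))

  disagree-antipode : ∀ b c → count (disagreeIn b (antipode c)) (allFin n) ≡ count (agreeIn b c) (allFin n)
  disagree-antipode b c = count-cong (allFin n) (λ i _ → trans (cong (disagreeing (lookup b i))
      (lookup-antipode c i)) (disagreeing-neg (lookup b i) (lookup c i)))

  Balanced : Face n → Face n → Set
  Balanced a b = count (agreeIn a b) (allFin n) ≡ 2 × count (disagreeIn a b) (allFin n) ≡ 2

  balanced? : Dec (Any (λ a → Any (Balanced a) A) A)
  balanced? = Any.any? (λ a → Any.any? (λ b → (count (agreeIn a b) (allFin n) ℕ.≟ 2) ×-dec
      (count (disagreeIn a b) (allFin n) ℕ.≟ 2)) A) A

  fromBalanced : Any (λ a → Any (Balanced a) A) A → Goal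
  fromBalanced found with find found
  ... | a , a∈ , found′ with find found′
  ...   | b , b∈ , agree≡ , disagree≡ = start-sound false (λ ()) a∈ b∈ 1 1 agree≡ disagree≡ refl refl balanced-explored

  fromUnbalanced : ¬ Any (λ a → Any (Balanced a) A) A → Goal
  fromUnbalanced none = bySplit _ _ refl refl (proj₁ (proj₂ (proj₂ near)))
      (proj₁ (proj₂ (proj₂ (proj₂ near)))) (proj₂ (proj₂ (proj₂ (proj₂ near))))
    where
    unbalanced : true ≡ true → ∀ {a b} → a ∈ₗ A → b ∈ₗ A → ¬ Balanced a b
    unbalanced _ a∈ b∈ bal = none (lose a∈ (lose b∈ bal))
    someFace : ∃ λ a → a ∈ₗ A × Vec.replicate n true ∈F a
    someFace = covers (Vec.replicate n true)
    b : Face n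
    b = proj₁ someFace
    b∈ : b ∈ₗ A
    b∈ = proj₁ (proj₂ someFace)
    near : ∃ λ c → c ∈ₗ A × 1 ℕ.≤ count (agreeIn b c) (allFin n) × 1 ℕ.≤ count (disagreeIn b c) (allFin n)
      × count (agreeIn b c) (allFin n) ℕ.+ count (disagreeIn b c) (allFin n) ≡ 4
    near = neighbour b∈ (proj₁ (hasFixed b∈)) (proj₂ (hasFixed b∈))
    c : Face n
    c = proj₁ near
    c∈ : c ∈ₗ A
    c∈ = proj₁ (proj₂ near)
    bySplit : ∀ g d → count (agreeIn b c) (allFin n) ≡ g → count (disagreeIn b c) (allFin n) ≡ d → 1 ℕ.≤ count
        (agreeIn b c) (allFin n) →
      1 ℕ.≤ count (disagreeIn b c) (allFin n) → count (agreeIn b c) (allFin n) ℕ.+ count (disagreeIn b c)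
          (allFin n) ≡ 4 → Goal
    bySplit g d agree≡ disagree≡ 1≤g 1≤d four = cases g d agree≡ disagree≡
      (subst (1 ℕ.≤_) agree≡ 1≤g) (subst (1 ℕ.≤_) disagree≡ 1≤d) (trans (sym (cong₂ ℕ._+_ agree≡ disagree≡)) four)
      where
      cases : ∀ g d → count (agreeIn b c) (allFin n) ≡ g → count (disagreeIn b c) (allFin n) ≡ d → 1 ℕ.≤ g →
          1 ℕ.≤ d → g ℕ.+ d ≡ 4 → Goal
      -- Passing to the antipode of `c` turns 1 + 3 into 3 + 1. The arguments `2 0` are the
      -- predecessors of 3 and 1.
      cases 1 _ agree≡ disagree≡ _ _ refl = start-sound true unbalanced b∈ (antipode∈ c∈) 2 0
        (trans (agree-antipode b c) disagree≡) (trans (disagree-antipode b c) agree≡) refl refl unbalanced-explored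
      cases 2 _ agree≡ disagree≡ _ _ refl = ⊥-elim (unbalanced refl b∈ c∈ (agree≡ , disagree≡))
      cases 3 _ agree≡ disagree≡ _ _ refl =
          start-sound true unbalanced b∈ c∈ 2 0 agree≡ disagree≡ refl refl unbalanced-explored
      cases (suc (suc (suc (suc g)))) (suc d) _ _ _ _ eq with () ← ℕₚ.suc-injective (ℕₚ.suc-injective
          (ℕₚ.suc-injective (ℕₚ.suc-injective (trans (sym (ℕₚ.+-suc (suc (suc (suc (suc g)))) d)) eq))))

  theorem : Goal
  theorem with balanced?
  ... | yes found = fromBalanced found
  ... | no  none  = fromUnbalanced none

theorem2 : (n : ℕ) → n ≥ 5 → (A : List (Face n)) → AntipodalSplitting n 5 A →
    Equivalent (βColl A) E ⊎ Equivalent (βColl A) F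
theorem2 n n≥5 A S = Conclusion.theorem n≥5 S
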